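{- There is an effective procedure which assigns to each $\Sigma_1$-sentence $\sigma$ of $\mathbb{L}_{\sf a}$ an $\mathbb{L}_{\sf a}$-sentence $[\sigma]$ such that: (1) $[\sigma] \vdash \sigma$; (2) if $\mathbb{N} \models \sigma$, then $\mathsf{R}_0 \vdash [\sigma]$; (3) if $\mathbb{N} \models \neg\sigma$, then $[\sigma] \vdash \mathsf{R}_0$.
   Context: $\mathbb{L}_{\sf a}$ is the first-order signature $\{0, \mathsf{S}, +, \times, \leq\}$ in which $\leq$ is a primitive binary relation symbol. For $n \in \omega$, $\overline{n}$ denotes the numeral $\mathsf{S}\cdots\mathsf{S}0$ with $n$ occurrences of $\mathsf{S}$. $\mathsf{R}_0$ is the $\mathbb{L}_{\sf a}$-theory with axioms, for all $m, n \in \omega$: $\overline{m}+\overline{n} = \overline{m+n}$; $\overline{m}\times\overline{n} = \overline{m\times n}$; $\overline{m} \neq \overline{n}$ if $m \neq n$; $\forall x\,(x \leq \overline{n} \to \bigvee_{i\leq n} x = \overline{i})$; $\overline{m} \leq \overline{n}$ if $m \leq n$. A $\Sigma_1$-formula is one of the form $\exists \vec{x}\,\delta$ with $\delta$ a $\Delta_0$ (bounded-quantifier) formula. $\mathbb{N}$ is the standard model. -}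

module Defs where

open import Data.Nat using (ℕ; zero; suc) renaming (_+_ to _+ℕ_; _*_ to _*ℕ_; _≤_ to _≤ℕ_)
open import Data.Fin using (Fin; zero; suc)
open import Data.List using (List; []; _∷_; map)
open import Data.List.Membership.Propositional using (_∈_)
open import Data.Product using (Σ; _×_; _,_)
open import Data.Sum using (_⊎_)
open import Data.Empty using (⊥)
open import Relation.Binary.PropositionalEquality using (_≡_; _≢_)

infixl 6 _⊕_
infixl 7 _⊗_

data Term (n : ℕ) : Set where
  var : Fin n → Term n
  `0  : Term n
  `S  : Term n → Term n
  _⊕_ : Term n → Term n → Term n
  _⊗_ : Term n → Term n → Term n

infix 4 _≐_ _≼_
infixr 3 _⇒_
infixr 4 _∨_
infixr 5 _∧_

data Formula (n : ℕ) : Set where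
  ⊥'  : Formula n
  _≐_ : Term n → Term n → Formula n
  _≼_ : Term n → Term n → Formula n
  _⇒_ : Formula n → Formula n → Formula n
  _∧_ : Formula n → Formula n → Formula n
  _∨_ : Formula n → Formula n → Formula n
  ∀'  : Formula (suc n) → Formula n
  ∃'  : Formula (suc n) → Formula n

¬' : ∀ {n} → Formula n → Formula n
¬' φ = φ ⇒ ⊥'

Sentence : Set
Sentence = Formula 0

num : ∀ {n} → ℕ → Term n
num zero    = `0
num (suc k) = `S (num k)

liftR : ∀ {n m} → (Fin n → Fin m) → Fin (suc n) → Fin (suc m)
liftR ρ zero    = zero
liftR ρ (suc i) = suc (ρ i)

renT : ∀ {n m} → (Fin n → Fin m) → Term n → Term m
renT ρ (var i) = var (ρ i)
renT ρ `0      = `0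
renT ρ (`S t)  = `S (renT ρ t)
renT ρ (s ⊕ t) = renT ρ s ⊕ renT ρ t
renT ρ (s ⊗ t) = renT ρ s ⊗ renT ρ t

renF : ∀ {n m} → (Fin n → Fin m) → Formula n → Formula m
renF ρ ⊥'      = ⊥'
renF ρ (s ≐ t) = renT ρ s ≐ renT ρ t
renF ρ (s ≼ t) = renT ρ s ≼ renT ρ t
renF ρ (φ ⇒ ψ) = renF ρ φ ⇒ renF ρ ψ
renF ρ (φ ∧ ψ) = renF ρ φ ∧ renF ρ ψ
renF ρ (φ ∨ ψ) = renF ρ φ ∨ renF ρ ψ
renF ρ (∀' φ)  = ∀' (renF (liftR ρ) φ)
renF ρ (∃' φ)  = ∃' (renF (liftR ρ) φ)

wkT : ∀ {n} → Term n → Term (suc n)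
wkT = renT suc

wkF : ∀ {n} → Formula n → Formula (suc n)
wkF = renF suc

closedF : ∀ {n} → Sentence → Formula n
closedF = renF (λ ())

liftS : ∀ {n m} → (Fin n → Term m) → Fin (suc n) → Term (suc m)
liftS σ zero    = var zero
liftS σ (suc i) = wkT (σ i)

subT : ∀ {n m} → (Fin n → Term m) → Term n → Term m
subT σ (var i) = σ i
subT σ `0      = `0
subT σ (`S t)  = `S (subT σ t)
subT σ (s ⊕ t) = subT σ s ⊕ subT σ t
subT σ (s ⊗ t) = subT σ s ⊗ subT σ t

subF : ∀ {n m} → (Fin n → Term m) → Formula n → Formula m
subF σ ⊥'      = ⊥'
subF σ (s ≐ t) = subT σ s ≐ subT σ t
subF σ (s ≼ t) = subT σ s ≼ subT σ t
subF σ (φ ⇒ ψ) = subF σ φ ⇒ subF σ ψ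
subF σ (φ ∧ ψ) = subF σ φ ∧ subF σ ψ
subF σ (φ ∨ ψ) = subF σ φ ∨ subF σ ψ
subF σ (∀' φ)  = ∀' (subF (liftS σ) φ)
subF σ (∃' φ)  = ∃' (subF (liftS σ) φ)

single : ∀ {n} → Term n → Fin (suc n) → Term n
single t zero    = t
single t (suc i) = var i

_[_] : ∀ {n} → Formula (suc n) → Term n → Formula n
φ [ t ] = subF (single t) φ

∀≤ : ∀ {n} → Term n → Formula (suc n) → Formula n
∀≤ t φ = ∀' ((var zero ≼ wkT t) ⇒ φ)

∃≤ : ∀ {n} → Term n → Formula (suc n) → Formula n
∃≤ t φ = ∃' ((var zero ≼ wkT t) ∧ φ)

data Δ₀ {n : ℕ} : Formula n → Set where
  δ⊥ : Δ₀ ⊥'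
  δ≐ : ∀ s t → Δ₀ (s ≐ t)
  δ≼ : ∀ s t → Δ₀ (s ≼ t)
  δ⇒ : ∀ {φ ψ} → Δ₀ φ → Δ₀ ψ → Δ₀ (φ ⇒ ψ)
  δ∧ : ∀ {φ ψ} → Δ₀ φ → Δ₀ ψ → Δ₀ (φ ∧ ψ)
  δ∨ : ∀ {φ ψ} → Δ₀ φ → Δ₀ ψ → Δ₀ (φ ∨ ψ)
  δ∀≤ : ∀ t {φ} → Δ₀ φ → Δ₀ (∀≤ t φ)
  δ∃≤ : ∀ t {φ} → Δ₀ φ → Δ₀ (∃≤ t φ)

data Σ₁ {n : ℕ} : Formula n → Set where
  σΔ₀ : ∀ {φ} → Δ₀ φ → Σ₁ φ
  σ∃  : ∀ {φ} → Σ₁ φ → Σ₁ (∃' φ)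

evalT : ∀ {n} → (Fin n → ℕ) → Term n → ℕ
evalT ρ (var i) = ρ i
evalT ρ `0      = zero
evalT ρ (`S t)  = suc (evalT ρ t)
evalT ρ (s ⊕ t) = evalT ρ s +ℕ evalT ρ t
evalT ρ (s ⊗ t) = evalT ρ s *ℕ evalT ρ t

extend : ∀ {n} → (Fin n → ℕ) → ℕ → Fin (suc n) → ℕ
extend ρ a zero    = a
extend ρ a (suc i) = ρ i

Sat : ∀ {n} → (Fin n → ℕ) → Formula n → Set
Sat ρ ⊥'      = ⊥
Sat ρ (s ≐ t) = evalT ρ s ≡ evalT ρ t
Sat ρ (s ≼ t) = evalT ρ s ≤ℕ evalT ρ t
Sat ρ (φ ⇒ ψ) = Sat ρ φ → Sat ρ ψ
Sat ρ (φ ∧ ψ) = Sat ρ φ × Sat ρ ψ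
Sat ρ (φ ∨ ψ) = Sat ρ φ ⊎ Sat ρ ψ
Sat ρ (∀' φ)  = (a : ℕ) → Sat (extend ρ a) φ
Sat ρ (∃' φ)  = Σ ℕ (λ a → Sat (extend ρ a) φ)

ℕ⊨ : Sentence → Set
ℕ⊨ σ = Sat (λ ()) σ

Theory : Set₁
Theory = Sentence → Set

infix 2 _⨾_⊢_

data _⨾_⊢_ (T : Theory) : ∀ {n} → List (Formula n) → Formula n → Set₁ where
  ax    : ∀ {n} {Γ : List (Formula n)} {ψ} → T ψ → T ⨾ Γ ⊢ closedF ψ
  hyp   : ∀ {n} {Γ : List (Formula n)} {φ} → φ ∈ Γ → T ⨾ Γ ⊢ φ
  ⇒I    : ∀ {n} {Γ : List (Formula n)} {φ ψ} → T ⨾ φ ∷ Γ ⊢ ψ → T ⨾ Γ ⊢ φ ⇒ ψ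
  ⇒E    : ∀ {n} {Γ : List (Formula n)} {φ ψ} → T ⨾ Γ ⊢ φ ⇒ ψ → T ⨾ Γ ⊢ φ → T ⨾ Γ ⊢ ψ
  ∧I    : ∀ {n} {Γ : List (Formula n)} {φ ψ} → T ⨾ Γ ⊢ φ → T ⨾ Γ ⊢ ψ → T ⨾ Γ ⊢ φ ∧ ψ
  ∧E₁   : ∀ {n} {Γ : List (Formula n)} {φ ψ} → T ⨾ Γ ⊢ φ ∧ ψ → T ⨾ Γ ⊢ φ
  ∧E₂   : ∀ {n} {Γ : List (Formula n)} {φ ψ} → T ⨾ Γ ⊢ φ ∧ ψ → T ⨾ Γ ⊢ ψ
  ∨I₁   : ∀ {n} {Γ : List (Formula n)} {φ ψ} → T ⨾ Γ ⊢ φ → T ⨾ Γ ⊢ φ ∨ ψ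
  ∨I₂   : ∀ {n} {Γ : List (Formula n)} {φ ψ} → T ⨾ Γ ⊢ ψ → T ⨾ Γ ⊢ φ ∨ ψ
  ∨E    : ∀ {n} {Γ : List (Formula n)} {φ ψ χ} → T ⨾ Γ ⊢ φ ∨ ψ →
          T ⨾ φ ∷ Γ ⊢ χ → T ⨾ ψ ∷ Γ ⊢ χ → T ⨾ Γ ⊢ χ
  raa   : ∀ {n} {Γ : List (Formula n)} {φ} → T ⨾ ¬' φ ∷ Γ ⊢ ⊥' → T ⨾ Γ ⊢ φ
  ∀I    : ∀ {n} {Γ : List (Formula n)} {φ} → T ⨾ map wkF Γ ⊢ φ → T ⨾ Γ ⊢ ∀' φ
  ∀E    : ∀ {n} {Γ : List (Formula n)} {φ} → T ⨾ Γ ⊢ ∀' φ → (t : Term n) → T ⨾ Γ ⊢ φ [ t ]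
  ∃I    : ∀ {n} {Γ : List (Formula n)} {φ} (t : Term n) → T ⨾ Γ ⊢ φ [ t ] → T ⨾ Γ ⊢ ∃' φ
  ∃E    : ∀ {n} {Γ : List (Formula n)} {φ ψ} → T ⨾ Γ ⊢ ∃' φ →
          T ⨾ φ ∷ map wkF Γ ⊢ wkF ψ → T ⨾ Γ ⊢ ψ
  ≐refl : ∀ {n} {Γ : List (Formula n)} (t : Term n) → T ⨾ Γ ⊢ t ≐ t
  ≐subst : ∀ {n} {Γ : List (Formula n)} {s t : Term n} (φ : Formula (suc n)) →
          T ⨾ Γ ⊢ s ≐ t → T ⨾ Γ ⊢ φ [ s ] → T ⨾ Γ ⊢ φ [ t ]

infix 2 _⊢_
_⊢_ : Theory → Sentence → Set₁
T ⊢ σ = T ⨾ [] ⊢ σ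

⟨_⟩ : Sentence → Theory
⟨ φ ⟩ ψ = ψ ≡ φ

disj : ∀ {n} → ℕ → Formula (suc n)
disj zero    = var zero ≐ num zero
disj (suc k) = disj k ∨ (var zero ≐ num (suc k))

data R₀ : Theory where
  R₀+ : ∀ m n → R₀ (num m ⊕ num n ≐ num (m +ℕ n))
  R₀× : ∀ m n → R₀ (num m ⊗ num n ≐ num (m *ℕ n))
  R₀≠ : ∀ m n → m ≢ n → R₀ (¬' (num m ≐ num n))
  R₀≤ : ∀ n → R₀ (∀' ((var zero ≼ num n) ⇒ disj n))
  R₀≼ : ∀ m n → m ≤ℕ n → R₀ (num m ≼ num n)

_⊢all_ : Theory → Theory → Set₁
T ⊢all U = ∀ ψ → U ψ → T ⊢ ψ

{-# OPTIONS --safe #-}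

-- The bracket of σ is ∃b (Φ(b) ∧ σᵇ). Here Φ(b) is a finite list of laws of
-- successor, +, × and ≤ with all quantifiers bounded by b, and σᵇ is σ with
-- unnested atoms and all quantifiers, its unbounded leading ∃ included, bounded
-- by b.  σᵇ implies σ in pure logic.  If σ is true, σᵇ and Φ hold at any b
-- exceeding all witnesses and intermediate values of σ, and R₀ decides such flat
-- sentences about numerals.  If σ is false, argue inside the bracket: climbing
-- from 0 with the law "every y ≤ b equals b or has its successor ≤ b", either b
-- is a numeral j, and then the laws refute σʲ, or every numeral up to the size
-- of a given R₀ axiom lies below b, and then the laws prove that axiom.

module Submission where

open import Defs
open import Data.Product using (Σ; _×_; _,_; proj₁; proj₂)
open import Data.Nat as N using (ℕ; zero; suc; z≤n; s≤s)
open import Data.Nat.Properties as NP using ()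
open import Data.Fin using (Fin; zero; suc; #_)
open import Data.List using (List; []; _∷_; map; length; lookup)
open import Data.List.Membership.Propositional using (_∈_)
open import Data.List.Relation.Binary.Subset.Propositional using (_⊆_)
open import Data.List.Membership.Propositional.Properties using (∈-map⁺; ∈-map⁻)
open import Data.List.Relation.Unary.Any using (here; there)
open import Data.Sum using (_⊎_; inj₁; inj₂)
import Data.Sum
open import Data.Empty using (⊥; ⊥-elim)
open import Data.Unit using (⊤; tt)
open import Function using (_∘_; id)
open import Relation.Nullary using (¬_; Dec; yes; no)
open import Relation.Binary.PropositionalEquality hiding ([_])

liftR-cong : ∀ {n m} {r r' : Fin n → Fin m} → r ≗ r' → liftR r ≗ liftR r'
liftR-cong e zero = refl
liftR-cong e (suc i) = cong suc (e i)

renT-cong : ∀ {n m} {r r' : Fin n → Fin m} → r ≗ r' → ∀ t → renT r t ≡ renT r' t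
renT-cong e (var i) = cong var (e i)
renT-cong e `0 = refl
renT-cong e (`S t) = cong `S (renT-cong e t)
renT-cong e (s ⊕ t) = cong₂ _⊕_ (renT-cong e s) (renT-cong e t)
renT-cong e (s ⊗ t) = cong₂ _⊗_ (renT-cong e s) (renT-cong e t)

renF-cong : ∀ {n m} {r r' : Fin n → Fin m} → r ≗ r' → ∀ φ → renF r φ ≡ renF r' φ
renF-cong e ⊥' = refl
renF-cong e (s ≐ t) = cong₂ _≐_ (renT-cong e s) (renT-cong e t)
renF-cong e (s ≼ t) = cong₂ _≼_ (renT-cong e s) (renT-cong e t)
renF-cong e (φ ⇒ ψ) = cong₂ _⇒_ (renF-cong e φ) (renF-cong e ψ)
renF-cong e (φ ∧ ψ) = cong₂ _∧_ (renF-cong e φ) (renF-cong e ψ)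
renF-cong e (φ ∨ ψ) = cong₂ _∨_ (renF-cong e φ) (renF-cong e ψ)
renF-cong e (∀' φ) = cong ∀' (renF-cong (liftR-cong e) φ)
renF-cong e (∃' φ) = cong ∃' (renF-cong (liftR-cong e) φ)

renT-∘ : ∀ {n m k} (r2 : Fin m → Fin k) (r1 : Fin n → Fin m) t → renT r2 (renT r1 t) ≡ renT (r2 ∘ r1) t
renT-∘ r2 r1 (var i) = refl
renT-∘ r2 r1 `0 = refl
renT-∘ r2 r1 (`S t) = cong `S (renT-∘ r2 r1 t)
renT-∘ r2 r1 (s ⊕ t) = cong₂ _⊕_ (renT-∘ r2 r1 s) (renT-∘ r2 r1 t)
renT-∘ r2 r1 (s ⊗ t) = cong₂ _⊗_ (renT-∘ r2 r1 s) (renT-∘ r2 r1 t)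

liftR-∘ : ∀ {n m k} (r2 : Fin m → Fin k) (r1 : Fin n → Fin m) → liftR r2 ∘ liftR r1 ≗ liftR (r2 ∘ r1)
liftR-∘ r2 r1 zero = refl
liftR-∘ r2 r1 (suc i) = refl

renF-∘ : ∀ {n m k} (r2 : Fin m → Fin k) (r1 : Fin n → Fin m) φ → renF r2 (renF r1 φ) ≡ renF (r2 ∘ r1) φ
renF-∘ r2 r1 ⊥' = refl
renF-∘ r2 r1 (s ≐ t) = cong₂ _≐_ (renT-∘ r2 r1 s) (renT-∘ r2 r1 t)
renF-∘ r2 r1 (s ≼ t) = cong₂ _≼_ (renT-∘ r2 r1 s) (renT-∘ r2 r1 t)
renF-∘ r2 r1 (φ ⇒ ψ) = cong₂ _⇒_ (renF-∘ r2 r1 φ) (renF-∘ r2 r1 ψ)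
renF-∘ r2 r1 (φ ∧ ψ) = cong₂ _∧_ (renF-∘ r2 r1 φ) (renF-∘ r2 r1 ψ)
renF-∘ r2 r1 (φ ∨ ψ) = cong₂ _∨_ (renF-∘ r2 r1 φ) (renF-∘ r2 r1 ψ)
renF-∘ r2 r1 (∀' φ) = cong ∀' (trans (renF-∘ (liftR r2) (liftR r1) φ) (renF-cong (liftR-∘ r2 r1) φ))
renF-∘ r2 r1 (∃' φ) = cong ∃' (trans (renF-∘ (liftR r2) (liftR r1) φ) (renF-cong (liftR-∘ r2 r1) φ))

liftS-cong : ∀ {n m} {σ σ' : Fin n → Term m} → σ ≗ σ' → liftS σ ≗ liftS σ'
liftS-cong e zero = refl
liftS-cong e (suc i) = cong wkT (e i)

subT-cong : ∀ {n m} {σ σ' : Fin n → Term m} → σ ≗ σ' → ∀ t → subT σ t ≡ subT σ' t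
subT-cong e (var i) = e i
subT-cong e `0 = refl
subT-cong e (`S t) = cong `S (subT-cong e t)
subT-cong e (s ⊕ t) = cong₂ _⊕_ (subT-cong e s) (subT-cong e t)
subT-cong e (s ⊗ t) = cong₂ _⊗_ (subT-cong e s) (subT-cong e t)

subF-cong : ∀ {n m} {σ σ' : Fin n → Term m} → σ ≗ σ' → ∀ φ → subF σ φ ≡ subF σ' φ
subF-cong e ⊥' = refl
subF-cong e (s ≐ t) = cong₂ _≐_ (subT-cong e s) (subT-cong e t)
subF-cong e (s ≼ t) = cong₂ _≼_ (subT-cong e s) (subT-cong e t)
subF-cong e (φ ⇒ ψ) = cong₂ _⇒_ (subF-cong e φ) (subF-cong e ψ)
subF-cong e (φ ∧ ψ) = cong₂ _∧_ (subF-cong e φ) (subF-cong e ψ)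
subF-cong e (φ ∨ ψ) = cong₂ _∨_ (subF-cong e φ) (subF-cong e ψ)
subF-cong e (∀' φ) = cong ∀' (subF-cong (liftS-cong e) φ)
subF-cong e (∃' φ) = cong ∃' (subF-cong (liftS-cong e) φ)

renT-subT : ∀ {n m k} (r : Fin m → Fin k) (σ : Fin n → Term m) t → renT r (subT σ t) ≡ subT (renT r ∘ σ) t
renT-subT r σ (var i) = refl
renT-subT r σ `0 = refl
renT-subT r σ (`S t) = cong `S (renT-subT r σ t)
renT-subT r σ (s ⊕ t) = cong₂ _⊕_ (renT-subT r σ s) (renT-subT r σ t)
renT-subT r σ (s ⊗ t) = cong₂ _⊗_ (renT-subT r σ s) (renT-subT r σ t)

liftR∘liftS : ∀ {n m k} (r : Fin m → Fin k) (σ : Fin n → Term m) → renT (liftR r) ∘ liftS σ ≗ liftS (renT r ∘ σ)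
liftR∘liftS r σ zero = refl
liftR∘liftS r σ (suc i) = trans (renT-∘ (liftR r) suc (σ i)) (sym (renT-∘ suc r (σ i)))

renF-subF : ∀ {n m k} (r : Fin m → Fin k) (σ : Fin n → Term m) φ → renF r (subF σ φ) ≡ subF (renT r ∘ σ) φ
renF-subF r σ ⊥' = refl
renF-subF r σ (s ≐ t) = cong₂ _≐_ (renT-subT r σ s) (renT-subT r σ t)
renF-subF r σ (s ≼ t) = cong₂ _≼_ (renT-subT r σ s) (renT-subT r σ t)
renF-subF r σ (φ ⇒ ψ) = cong₂ _⇒_ (renF-subF r σ φ) (renF-subF r σ ψ)
renF-subF r σ (φ ∧ ψ) = cong₂ _∧_ (renF-subF r σ φ) (renF-subF r σ ψ)
renF-subF r σ (φ ∨ ψ) = cong₂ _∨_ (renF-subF r σ φ) (renF-subF r σ ψ)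
renF-subF r σ (∀' φ) = cong ∀' (trans (renF-subF (liftR r) (liftS σ) φ) (subF-cong (liftR∘liftS r σ) φ))
renF-subF r σ (∃' φ) = cong ∃' (trans (renF-subF (liftR r) (liftS σ) φ) (subF-cong (liftR∘liftS r σ) φ))

subT-renT : ∀ {n m k} (σ : Fin m → Term k) (r : Fin n → Fin m) t → subT σ (renT r t) ≡ subT (σ ∘ r) t
subT-renT σ r (var i) = refl
subT-renT σ r `0 = refl
subT-renT σ r (`S t) = cong `S (subT-renT σ r t)
subT-renT σ r (s ⊕ t) = cong₂ _⊕_ (subT-renT σ r s) (subT-renT σ r t)
subT-renT σ r (s ⊗ t) = cong₂ _⊗_ (subT-renT σ r s) (subT-renT σ r t)

liftS∘liftR : ∀ {n m k} (σ : Fin m → Term k) (r : Fin n → Fin m) → liftS σ ∘ liftR r ≗ liftS (σ ∘ r)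
liftS∘liftR σ r zero = refl
liftS∘liftR σ r (suc i) = refl

subF-renF : ∀ {n m k} (σ : Fin m → Term k) (r : Fin n → Fin m) φ → subF σ (renF r φ) ≡ subF (σ ∘ r) φ
subF-renF σ r ⊥' = refl
subF-renF σ r (s ≐ t) = cong₂ _≐_ (subT-renT σ r s) (subT-renT σ r t)
subF-renF σ r (s ≼ t) = cong₂ _≼_ (subT-renT σ r s) (subT-renT σ r t)
subF-renF σ r (φ ⇒ ψ) = cong₂ _⇒_ (subF-renF σ r φ) (subF-renF σ r ψ)
subF-renF σ r (φ ∧ ψ) = cong₂ _∧_ (subF-renF σ r φ) (subF-renF σ r ψ)
subF-renF σ r (φ ∨ ψ) = cong₂ _∨_ (subF-renF σ r φ) (subF-renF σ r ψ)
subF-renF σ r (∀' φ) = cong ∀' (trans (subF-renF (liftS σ) (liftR r) φ) (subF-cong (liftS∘liftR σ r) φ))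
subF-renF σ r (∃' φ) = cong ∃' (trans (subF-renF (liftS σ) (liftR r) φ) (subF-cong (liftS∘liftR σ r) φ))

subT-subT : ∀ {n m k} (σ2 : Fin m → Term k) (σ1 : Fin n → Term m) t → subT σ2 (subT σ1 t) ≡ subT (subT σ2 ∘ σ1) t
subT-subT σ2 σ1 (var i) = refl
subT-subT σ2 σ1 `0 = refl
subT-subT σ2 σ1 (`S t) = cong `S (subT-subT σ2 σ1 t)
subT-subT σ2 σ1 (s ⊕ t) = cong₂ _⊕_ (subT-subT σ2 σ1 s) (subT-subT σ2 σ1 t)
subT-subT σ2 σ1 (s ⊗ t) = cong₂ _⊗_ (subT-subT σ2 σ1 s) (subT-subT σ2 σ1 t)

subT-liftS-wkT : ∀ {n m} (σ : Fin n → Term m) t → subT (liftS σ) (wkT t) ≡ wkT (subT σ t)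
subT-liftS-wkT σ t = trans (subT-renT (liftS σ) suc t) (sym (renT-subT suc σ t))

subT∘liftS : ∀ {n m k} (σ2 : Fin m → Term k) (σ1 : Fin n → Term m) → subT (liftS σ2) ∘ liftS σ1 ≗ liftS (subT σ2 ∘ σ1)
subT∘liftS σ2 σ1 zero = refl
subT∘liftS σ2 σ1 (suc i) = subT-liftS-wkT σ2 (σ1 i)

subF-subF : ∀ {n m k} (σ2 : Fin m → Term k) (σ1 : Fin n → Term m) φ → subF σ2 (subF σ1 φ) ≡ subF (subT σ2 ∘ σ1) φ
subF-subF σ2 σ1 ⊥' = refl
subF-subF σ2 σ1 (s ≐ t) = cong₂ _≐_ (subT-subT σ2 σ1 s) (subT-subT σ2 σ1 t)
subF-subF σ2 σ1 (s ≼ t) = cong₂ _≼_ (subT-subT σ2 σ1 s) (subT-subT σ2 σ1 t)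
subF-subF σ2 σ1 (φ ⇒ ψ) = cong₂ _⇒_ (subF-subF σ2 σ1 φ) (subF-subF σ2 σ1 ψ)
subF-subF σ2 σ1 (φ ∧ ψ) = cong₂ _∧_ (subF-subF σ2 σ1 φ) (subF-subF σ2 σ1 ψ)
subF-subF σ2 σ1 (φ ∨ ψ) = cong₂ _∨_ (subF-subF σ2 σ1 φ) (subF-subF σ2 σ1 ψ)
subF-subF σ2 σ1 (∀' φ) = cong ∀' (trans (subF-subF (liftS σ2) (liftS σ1) φ) (subF-cong (subT∘liftS σ2 σ1) φ))
subF-subF σ2 σ1 (∃' φ) = cong ∃' (trans (subF-subF (liftS σ2) (liftS σ1) φ) (subF-cong (subT∘liftS σ2 σ1) φ))

liftS-var : ∀ {n m} (r : Fin n → Fin m) → liftS (var ∘ r) ≗ var ∘ liftR r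
liftS-var r zero = refl
liftS-var r (suc i) = refl

subT-var : ∀ {n m} (r : Fin n → Fin m) t → subT (var ∘ r) t ≡ renT r t
subT-var r (var i) = refl
subT-var r `0 = refl
subT-var r (`S t) = cong `S (subT-var r t)
subT-var r (s ⊕ t) = cong₂ _⊕_ (subT-var r s) (subT-var r t)
subT-var r (s ⊗ t) = cong₂ _⊗_ (subT-var r s) (subT-var r t)

subF-var : ∀ {n m} (r : Fin n → Fin m) φ → subF (var ∘ r) φ ≡ renF r φ
subF-var r ⊥' = refl
subF-var r (s ≐ t) = cong₂ _≐_ (subT-var r s) (subT-var r t)
subF-var r (s ≼ t) = cong₂ _≼_ (subT-var r s) (subT-var r t)
subF-var r (φ ⇒ ψ) = cong₂ _⇒_ (subF-var r φ) (subF-var r ψ)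
subF-var r (φ ∧ ψ) = cong₂ _∧_ (subF-var r φ) (subF-var r ψ)
subF-var r (φ ∨ ψ) = cong₂ _∨_ (subF-var r φ) (subF-var r ψ)
subF-var r (∀' φ) = cong ∀' (trans (subF-cong (liftS-var r) φ) (subF-var (liftR r) φ))
subF-var r (∃' φ) = cong ∃' (trans (subF-cong (liftS-var r) φ) (subF-var (liftR r) φ))

liftR-id : ∀ {n} → liftR {n} id ≗ id
liftR-id zero = refl
liftR-id (suc i) = refl

renT-id : ∀ {n} (t : Term n) → renT id t ≡ t
renT-id (var i) = refl
renT-id `0 = refl
renT-id (`S t) = cong `S (renT-id t)
renT-id (s ⊕ t) = cong₂ _⊕_ (renT-id s) (renT-id t)
renT-id (s ⊗ t) = cong₂ _⊗_ (renT-id s) (renT-id t)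

renF-id : ∀ {n} (φ : Formula n) → renF id φ ≡ φ
renF-id ⊥' = refl
renF-id (s ≐ t) = cong₂ _≐_ (renT-id s) (renT-id t)
renF-id (s ≼ t) = cong₂ _≼_ (renT-id s) (renT-id t)
renF-id (φ ⇒ ψ) = cong₂ _⇒_ (renF-id φ) (renF-id ψ)
renF-id (φ ∧ ψ) = cong₂ _∧_ (renF-id φ) (renF-id ψ)
renF-id (φ ∨ ψ) = cong₂ _∨_ (renF-id φ) (renF-id ψ)
renF-id (∀' φ) = cong ∀' (trans (renF-cong liftR-id φ) (renF-id φ))
renF-id (∃' φ) = cong ∃' (trans (renF-cong liftR-id φ) (renF-id φ))

renT-num : ∀ {n m} (r : Fin n → Fin m) k → renT r (num k) ≡ num k
renT-num r zero = refl
renT-num r (suc k) = cong `S (renT-num r k)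

subT-num : ∀ {n m} (σ : Fin n → Term m) k → subT σ (num k) ≡ num k
subT-num σ zero = refl
subT-num σ (suc k) = cong `S (subT-num σ k)

wkT-num : ∀ {n} k → wkT {n} (num k) ≡ num k
wkT-num = renT-num suc

subT-single-wkT : ∀ {n} (u : Term n) t → subT (single u) (wkT t) ≡ t
subT-single-wkT u t = trans (subT-renT (single u) suc t) (trans (subT-var id t) (renT-id t))

renF-closedF : ∀ {n m} (r : Fin n → Fin m) (ψ : Sentence) → renF r (closedF ψ) ≡ closedF ψ
renF-closedF r ψ = trans (renF-∘ r (λ ()) ψ) (renF-cong (λ ()) ψ)

closedF-id : (ψ : Sentence) → closedF ψ ≡ ψ
closedF-id ψ = trans (renF-cong (λ ()) ψ) (renF-id ψ)

cast : ∀ {T n} {Γ : List (Formula n)} {A B} → A ≡ B → T ⨾ Γ ⊢ A → T ⨾ Γ ⊢ B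
cast refl d = d

_⊆[_]_ : ∀ {n m} → List (Formula n) → (Fin n → Fin m) → List (Formula m) → Set
Γ ⊆[ r ] Δ = ∀ {ψ} → ψ ∈ Γ → renF r ψ ∈ Δ

renT∘single : ∀ {n m} (r : Fin n → Fin m) (t : Term n) → renT r ∘ single t ≗ single (renT r t) ∘ liftR r
renT∘single r t zero = refl
renT∘single r t (suc i) = refl

renF-inst : ∀ {n m} (r : Fin n → Fin m) (φ : Formula (suc n)) t →
           renF r (φ [ t ]) ≡ (renF (liftR r) φ) [ renT r t ]
renF-inst r φ t = trans (renF-subF r (single t) φ)
                 (trans (subF-cong (renT∘single r t) φ) (sym (subF-renF (single (renT r t)) (liftR r) φ)))

renF-liftR-wkF : ∀ {n m} (r : Fin n → Fin m) (φ : Formula n) → renF (liftR r) (wkF φ) ≡ wkF (renF r φ)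
renF-liftR-wkF r φ = trans (renF-∘ (liftR r) suc φ) (sym (renF-∘ suc r φ))

rename-map-wkF : ∀ {n m} {Γ : List (Formula n)} {Δ : List (Formula m)} (r : Fin n → Fin m) →
        Γ ⊆[ r ] Δ → map wkF Γ ⊆[ liftR r ] map wkF Δ
rename-map-wkF r h p with ∈-map⁻ wkF p
... | χ , q , refl = subst (_∈ _) (sym (renF-liftR-wkF r χ)) (∈-map⁺ wkF (h q))

rename-∷ : ∀ {n m} {Γ : List (Formula n)} {Δ : List (Formula m)} (r : Fin n → Fin m) {φ} →
        Γ ⊆[ r ] Δ → (φ ∷ Γ) ⊆[ r ] (renF r φ ∷ Δ)
rename-∷ r h (here refl) = here refl
rename-∷ r h (there p) = there (h p)

⊢-rename : ∀ {T n m} {Γ : List (Formula n)} {Δ : List (Formula m)} {φ} (r : Fin n → Fin m) →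
      Γ ⊆[ r ] Δ → T ⨾ Γ ⊢ φ → T ⨾ Δ ⊢ renF r φ
⊢-rename r h (ax {ψ = ψ} x) = cast (sym (renF-closedF r ψ)) (ax x)
⊢-rename r h (hyp x) = hyp (h x)
⊢-rename r h (⇒I d) = ⇒I (⊢-rename r (rename-∷ r h) d)
⊢-rename r h (⇒E d d₁) = ⇒E (⊢-rename r h d) (⊢-rename r h d₁)
⊢-rename r h (∧I d d₁) = ∧I (⊢-rename r h d) (⊢-rename r h d₁)
⊢-rename r h (∧E₁ d) = ∧E₁ (⊢-rename r h d)
⊢-rename r h (∧E₂ d) = ∧E₂ (⊢-rename r h d)
⊢-rename r h (∨I₁ d) = ∨I₁ (⊢-rename r h d)
⊢-rename r h (∨I₂ d) = ∨I₂ (⊢-rename r h d)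
⊢-rename r h (∨E d d₁ d₂) = ∨E (⊢-rename r h d) (⊢-rename r (rename-∷ r h) d₁) (⊢-rename r (rename-∷ r h) d₂)
⊢-rename r h (raa d) = raa (⊢-rename r (rename-∷ r h) d)
⊢-rename r h (∀I d) = ∀I (⊢-rename (liftR r) (rename-map-wkF r h) d)
⊢-rename r h (∀E {φ = φ} d t) = cast (sym (renF-inst r φ t)) (∀E (⊢-rename r h d) (renT r t))
⊢-rename r h (∃I {φ = φ} t d) = ∃I (renT r t) (cast (renF-inst r φ t) (⊢-rename r h d))
⊢-rename r h (∃E {ψ = ψ} d d₁) =
  ∃E (⊢-rename r h d) (cast (renF-liftR-wkF r ψ)
       (⊢-rename (liftR r) (λ { (here refl) → here refl ; (there p) → there (rename-map-wkF r h p) }) d₁))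
⊢-rename r h (≐refl t) = ≐refl (renT r t)
⊢-rename r h (≐subst {s = s} {t = t} φ d d₁) =
  cast (sym (renF-inst r φ t))
    (≐subst (renF (liftR r) φ) (⊢-rename r h d) (cast (renF-inst r φ s) (⊢-rename r h d₁)))

⊢-weaken : ∀ {T n} {Γ Δ : List (Formula n)} {φ} → Γ ⊆ Δ → T ⨾ Γ ⊢ φ → T ⨾ Δ ⊢ φ
⊢-weaken {φ = φ} h d = cast (renF-id φ)
  (⊢-rename id (λ {ψ} p → subst (_∈ _) (sym (renF-id ψ)) (h p)) d)

⊢-explode : ∀ {T n} {Γ : List (Formula n)} → T ⨾ Γ ⊢ ⊥' → ∀ {φ} → T ⨾ Γ ⊢ φ
⊢-explode d = raa (⊢-weaken there d)

≐-rewrite : ∀ {T n} {Γ : List (Formula n)} (χ : Formula (suc n)) {s t A B} →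
     T ⨾ Γ ⊢ s ≐ t → χ [ s ] ≡ A → χ [ t ] ≡ B → T ⨾ Γ ⊢ A → T ⨾ Γ ⊢ B
≐-rewrite χ e p q d = cast q (≐subst χ e (cast (sym p) d))

≐sym : ∀ {T n} {Γ : List (Formula n)} {s t} → T ⨾ Γ ⊢ s ≐ t → T ⨾ Γ ⊢ t ≐ s
≐sym {s = s} {t} e = ≐-rewrite (var zero ≐ wkT s) e (cong (s ≐_) (subT-single-wkT s s)) (cong (t ≐_) (subT-single-wkT t s)) (≐refl s)

≐trans : ∀ {T n} {Γ : List (Formula n)} {s t u} → T ⨾ Γ ⊢ s ≐ t → T ⨾ Γ ⊢ t ≐ u → T ⨾ Γ ⊢ s ≐ u
≐trans {s = s} {t} {u} e1 e2 = ≐-rewrite (wkT s ≐ var zero) e2 (cong (_≐ t) (subT-single-wkT t s)) (cong (_≐ u) (subT-single-wkT u s)) e1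

-- Flat formulas are negation-normal, their atoms apply at most one function
-- symbol to variables, and each quantifier is bounded by a variable.

data Atom (k : ℕ) : Set where
  eqV : Fin k → Fin k → Atom k
  eqZ : Fin k → Atom k
  eqS : Fin k → Fin k → Atom k
  eqP : Fin k → Fin k → Fin k → Atom k
  eqT : Fin k → Fin k → Fin k → Atom k
  leV : Fin k → Fin k → Atom k

infixr 5 _∧F_
infixr 4 _∨F_

data Flat (k : ℕ) : Set where
  ttF ffF : Flat k
  pos neg : Atom k → Flat k
  _∧F_ _∨F_ : Flat k → Flat k → Flat k
  ∀F ∃F : Fin k → Flat (suc k) → Flat k

atomFormula : ∀ {k m} → Atom k → (Fin k → Term m) → Formula m
atomFormula (eqV i j) τ = τ i ≐ τ j
atomFormula (eqZ i) τ = τ i ≐ `0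
atomFormula (eqS i j) τ = τ i ≐ `S (τ j)
atomFormula (eqP i j l) τ = τ i ≐ τ j ⊕ τ l
atomFormula (eqT i j l) τ = τ i ≐ τ j ⊗ τ l
atomFormula (leV i j) τ = τ i ≼ τ j

toFormula : ∀ {k m} → Flat k → (Fin k → Term m) → Formula m
toFormula ttF τ = ⊥' ⇒ ⊥'
toFormula ffF τ = ⊥'
toFormula (pos A) τ = atomFormula A τ
toFormula (neg A) τ = ¬' (atomFormula A τ)
toFormula (φ ∧F ψ) τ = toFormula φ τ ∧ toFormula ψ τ
toFormula (φ ∨F ψ) τ = toFormula φ τ ∨ toFormula ψ τ
toFormula (∀F i φ) τ = ∀≤ (τ i) (toFormula φ (liftS τ))
toFormula (∃F i φ) τ = ∃≤ (τ i) (toFormula φ (liftS τ))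

atomFormula-cong : ∀ {k m} (A : Atom k) {τ τ' : Fin k → Term m} → τ ≗ τ' → atomFormula A τ ≡ atomFormula A τ'
atomFormula-cong (eqV i j) e = cong₂ _≐_ (e i) (e j)
atomFormula-cong (eqZ i) e = cong (_≐ `0) (e i)
atomFormula-cong (eqS i j) e = cong₂ (λ a b → a ≐ `S b) (e i) (e j)
atomFormula-cong (eqP i j l) e = cong₂ _≐_ (e i) (cong₂ _⊕_ (e j) (e l))
atomFormula-cong (eqT i j l) e = cong₂ _≐_ (e i) (cong₂ _⊗_ (e j) (e l))
atomFormula-cong (leV i j) e = cong₂ _≼_ (e i) (e j)

toFormula-cong : ∀ {k m} (φ : Flat k) {τ τ' : Fin k → Term m} → τ ≗ τ' → toFormula φ τ ≡ toFormula φ τ'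
toFormula-cong ttF e = refl
toFormula-cong ffF e = refl
toFormula-cong (pos A) e = atomFormula-cong A e
toFormula-cong (neg A) e = cong ¬' (atomFormula-cong A e)
toFormula-cong (φ ∧F ψ) e = cong₂ _∧_ (toFormula-cong φ e) (toFormula-cong ψ e)
toFormula-cong (φ ∨F ψ) e = cong₂ _∨_ (toFormula-cong φ e) (toFormula-cong ψ e)
toFormula-cong (∀F i φ) e = cong₂ ∀≤ (e i) (toFormula-cong φ (liftS-cong e))
toFormula-cong (∃F i φ) e = cong₂ ∃≤ (e i) (toFormula-cong φ (liftS-cong e))

atomFormula-subst : ∀ {k m l} (A : Atom k) (σ : Fin m → Term l) (τ : Fin k → Term m) → subF σ (atomFormula A τ) ≡ atomFormula A (subT σ ∘ τ)
atomFormula-subst (eqV i j) σ τ = refl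
atomFormula-subst (eqZ i) σ τ = refl
atomFormula-subst (eqS i j) σ τ = refl
atomFormula-subst (eqP i j l) σ τ = refl
atomFormula-subst (eqT i j l) σ τ = refl
atomFormula-subst (leV i j) σ τ = refl

toFormula-subst : ∀ {k m l} (φ : Flat k) (σ : Fin m → Term l) (τ : Fin k → Term m) → subF σ (toFormula φ τ) ≡ toFormula φ (subT σ ∘ τ)
toFormula-subst ttF σ τ = refl
toFormula-subst ffF σ τ = refl
toFormula-subst (pos A) σ τ = atomFormula-subst A σ τ
toFormula-subst (neg A) σ τ = cong ¬' (atomFormula-subst A σ τ)
toFormula-subst (φ ∧F ψ) σ τ = cong₂ _∧_ (toFormula-subst φ σ τ) (toFormula-subst ψ σ τ)
toFormula-subst (φ ∨F ψ) σ τ = cong₂ _∨_ (toFormula-subst φ σ τ) (toFormula-subst ψ σ τ)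
toFormula-subst (∀F i φ) σ τ = cong₂ (λ a b → ∀' ((var zero ≼ a) ⇒ b)) (subT-liftS-wkT σ (τ i))
  (trans (toFormula-subst φ (liftS σ) (liftS τ)) (toFormula-cong φ (subT∘liftS σ τ)))
toFormula-subst (∃F i φ) σ τ = cong₂ (λ a b → ∃' ((var zero ≼ a) ∧ b)) (subT-liftS-wkT σ (τ i))
  (trans (toFormula-subst φ (liftS σ) (liftS τ)) (toFormula-cong φ (subT∘liftS σ τ)))

toFormula-rename : ∀ {k m l} (φ : Flat k) (r : Fin m → Fin l) (τ : Fin k → Term m) → renF r (toFormula φ τ) ≡ toFormula φ (renT r ∘ τ)
toFormula-rename φ r τ = trans (sym (subF-var r (toFormula φ τ))) (trans (toFormula-subst φ (var ∘ r) τ) (toFormula-cong φ (λ i → subT-var r (τ i))))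

consT : ∀ {k m} → Term m → (Fin k → Term m) → Fin (suc k) → Term m
consT u τ zero = u
consT u τ (suc i) = τ i

single∘liftS : ∀ {k m} (u : Term m) (τ : Fin k → Term m) → subT (single u) ∘ liftS τ ≗ consT u τ
single∘liftS u τ zero = refl
single∘liftS u τ (suc i) = subT-single-wkT u (τ i)

toFormula-inst : ∀ {k m} (φ : Flat (suc k)) (u : Term m) (τ : Fin k → Term m) → (toFormula φ (liftS τ)) [ u ] ≡ toFormula φ (consT u τ)
toFormula-inst φ u τ = trans (toFormula-subst φ (single u) (liftS τ)) (toFormula-cong φ (single∘liftS u τ))

∀F-elim : ∀ {T k m} {Γ : List (Formula m)} {i} {φ : Flat (suc k)} {τ} → T ⨾ Γ ⊢ toFormula (∀F i φ) τ → (u : Term m) →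
          T ⨾ Γ ⊢ u ≼ τ i → T ⨾ Γ ⊢ toFormula φ (consT u τ)
∀F-elim {i = i} {φ} {τ} d u p =
  cast (toFormula-inst φ u τ)
    (⇒E (cast (cong (λ z → (u ≼ z) ⇒ (toFormula φ (liftS τ)) [ u ]) (subT-single-wkT u (τ i))) (∀E d u)) p)

SatAtom : ∀ {k} → (Fin k → ℕ) → Atom k → Set
SatAtom ρ (eqV i j) = ρ i ≡ ρ j
SatAtom ρ (eqZ i) = ρ i ≡ 0
SatAtom ρ (eqS i j) = ρ i ≡ suc (ρ j)
SatAtom ρ (eqP i j l) = ρ i ≡ ρ j N.+ ρ l
SatAtom ρ (eqT i j l) = ρ i ≡ ρ j N.* ρ l
SatAtom ρ (leV i j) = ρ i N.≤ ρ j

SatFlat : ∀ {k} → (Fin k → ℕ) → Flat k → Set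
SatFlat ρ ttF = ⊤
SatFlat ρ ffF = ⊥
SatFlat ρ (pos A) = SatAtom ρ A
SatFlat ρ (neg A) = ¬ SatAtom ρ A
SatFlat ρ (φ ∧F ψ) = SatFlat ρ φ × SatFlat ρ ψ
SatFlat ρ (φ ∨F ψ) = SatFlat ρ φ ⊎ SatFlat ρ ψ
SatFlat ρ (∀F i φ) = ∀ a → a N.≤ ρ i → SatFlat (extend ρ a) φ
SatFlat ρ (∃F i φ) = Σ ℕ (λ a → a N.≤ ρ i × SatFlat (extend ρ a) φ)

disjOf : ∀ {n} → Term n → ℕ → Formula n
disjOf u zero = u ≐ num zero
disjOf u (suc k) = disjOf u k ∨ (u ≐ num (suc k))

subF-disj : ∀ {n} (u : Term n) a → subF (single u) (disj a) ≡ disjOf u a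
subF-disj u zero = cong (u ≐_) (subT-num (single u) zero)
subF-disj u (suc a) = cong₂ _∨_ (subF-disj u a) (cong (u ≐_) (subT-num (single u) (suc a)))

renF-disj : ∀ {n m} (r : Fin n → Fin m) a → renF (liftR r) (disj a) ≡ disj a
renF-disj r zero = cong (var zero ≐_) (renT-num (liftR r) zero)
renF-disj r (suc a) = cong₂ _∨_ (renF-disj r a) (cong (var zero ≐_) (renT-num (liftR r) (suc a)))

R₀≤-axiom : ℕ → ∀ {n} → Formula n
R₀≤-axiom a = ∀' ((var zero ≼ num a) ⇒ disj a)

renF-R₀≤-axiom : ∀ {n m} (r : Fin n → Fin m) a → renF r (R₀≤-axiom a) ≡ R₀≤-axiom a
renF-R₀≤-axiom r a = cong₂ (λ x y → ∀' ((var zero ≼ x) ⇒ y)) (renT-num (liftR r) a) (renF-disj r a)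

-- What both R₀ and the laws Φ(b) provide about the numerals up to s; it is all
-- that deciding flat formulas needs.
record NumeralFacts (T : Theory) {m} (Γ : List (Formula m)) (s : ℕ) : Set₁ where
  field
    num≢ : ∀ a c → a N.≤ s → c N.≤ s → a ≢ c → T ⨾ Γ ⊢ ¬' (num a ≐ num c)
    num≢S : ∀ a c → a N.≤ s → c N.≤ s → a ≢ suc c → T ⨾ Γ ⊢ ¬' (num a ≐ `S (num c))
    num+ : ∀ a c → a N.+ c N.≤ s → T ⨾ Γ ⊢ num a ⊕ num c ≐ num (a N.+ c)
    num+≢ : ∀ k a c → k N.≤ s → a N.≤ s → c N.≤ s → k ≢ a N.+ c → T ⨾ Γ ⊢ ¬' (num k ≐ num a ⊕ num c)
    num* : ∀ a c → a N.≤ s → c N.≤ s → a N.* c N.≤ s → T ⨾ Γ ⊢ num a ⊗ num c ≐ num (a N.* c)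
    num*≢ : ∀ k a c → k N.≤ s → a N.≤ s → c N.≤ s → k ≢ a N.* c → T ⨾ Γ ⊢ ¬' (num k ≐ num a ⊗ num c)
    num≤ : ∀ a c → a N.≤ c → c N.≤ s → T ⨾ Γ ⊢ num a ≼ num c
    num-R₀≤ : ∀ a → a N.≤ s → T ⨾ Γ ⊢ R₀≤-axiom a
open NumeralFacts public

NumeralFacts-weaken : ∀ {T m} {Γ Δ : List (Formula m)} {s} → Γ ⊆ Δ → NumeralFacts T Γ s → NumeralFacts T Δ s
NumeralFacts-weaken h F = record
  { num≢ = λ a c p q r → ⊢-weaken h (num≢ F a c p q r)
  ; num≢S = λ a c p q r → ⊢-weaken h (num≢S F a c p q r)
  ; num+ = λ a c p → ⊢-weaken h (num+ F a c p)
  ; num+≢ = λ k a c p q r x → ⊢-weaken h (num+≢ F k a c p q r x)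
  ; num* = λ a c p q r → ⊢-weaken h (num* F a c p q r)
  ; num*≢ = λ k a c p q r x → ⊢-weaken h (num*≢ F k a c p q r x)
  ; num≤ = λ a c p q → ⊢-weaken h (num≤ F a c p q)
  ; num-R₀≤ = λ a p → ⊢-weaken h (num-R₀≤ F a p) }

NumeralFacts-rename : ∀ {T n m} {Γ : List (Formula n)} {Δ : List (Formula m)} {s} (r : Fin n → Fin m) →
          Γ ⊆[ r ] Δ → NumeralFacts T Γ s → NumeralFacts T Δ s
NumeralFacts-rename r h F = record
  { num≢ = λ a c p q x → cast (cong₂ (λ u v → ¬' (u ≐ v)) (renT-num r a) (renT-num r c)) (⊢-rename r h (num≢ F a c p q x))
  ; num≢S = λ a c p q x → cast (cong₂ (λ u v → ¬' (u ≐ `S v)) (renT-num r a) (renT-num r c)) (⊢-rename r h (num≢S F a c p q x))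
  ; num+ = λ a c p → cast (cong₂ _≐_ (cong₂ _⊕_ (renT-num r a) (renT-num r c)) (renT-num r (a N.+ c))) (⊢-rename r h (num+ F a c p))
  ; num+≢ = λ k a c p q x y → cast (cong₂ (λ u v → ¬' (u ≐ v)) (renT-num r k) (cong₂ _⊕_ (renT-num r a) (renT-num r c))) (⊢-rename r h (num+≢ F k a c p q x y))
  ; num* = λ a c p q x → cast (cong₂ _≐_ (cong₂ _⊗_ (renT-num r a) (renT-num r c)) (renT-num r (a N.* c))) (⊢-rename r h (num* F a c p q x))
  ; num*≢ = λ k a c p q x y → cast (cong₂ (λ u v → ¬' (u ≐ v)) (renT-num r k) (cong₂ _⊗_ (renT-num r a) (renT-num r c))) (⊢-rename r h (num*≢ F k a c p q x y))
  ; num≤ = λ a c p q → cast (cong₂ _≼_ (renT-num r a) (renT-num r c)) (⊢-rename r h (num≤ F a c p q))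
  ; num-R₀≤ = λ a p → cast (renF-R₀≤-axiom r a) (⊢-rename r h (num-R₀≤ F a p)) }

≼-num⇒disj : ∀ {T m} {Γ : List (Formula m)} {s} {u} → NumeralFacts T Γ s → ∀ a → a N.≤ s → T ⨾ Γ ⊢ u ≼ num a → T ⨾ Γ ⊢ disjOf u a
≼-num⇒disj {u = u} F a p q =
  cast (subF-disj u a)
    (⇒E (cast (cong (λ z → (u ≼ z) ⇒ subF (single u) (disj a)) (subT-num (single u) a)) (∀E (num-R₀≤ F a p) u)) q)

disj-cases : ∀ {T m} {Γ : List (Formula m)} {u G} a → T ⨾ Γ ⊢ disjOf u a →
        (∀ c → c N.≤ a → T ⨾ (u ≐ num c) ∷ Γ ⊢ G) → T ⨾ Γ ⊢ G
disj-cases zero d f = ⇒E (⇒I (f zero z≤n)) d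
disj-cases (suc a) d f =
  ∨E d (disj-cases a (hyp (here refl)) (λ c p → ⊢-weaken (λ { (here e) → here e ; (there q) → there (there q) }) (f c (NP.m≤n⇒m≤1+n p))))
       (⊢-weaken (λ { (here e) → here e ; (there q) → there q }) (f (suc a) NP.≤-refl))

num≰-refute : ∀ {T m} {Γ : List (Formula m)} {s} → NumeralFacts T Γ s → ∀ a c → a N.≤ s → c N.< a → T ⨾ Γ ⊢ ¬' (num a ≼ num c)
num≰-refute F a c p q = ⇒I (disj-cases c (≼-num⇒disj (NumeralFacts-weaken there F) c (NP.≤-trans (NP.<⇒≤ q) p) (hyp (here refl)))
  (λ c' r → ⇒E (num≢ (NumeralFacts-weaken (λ x → there (there x)) F) a c' p (NP.≤-trans r (NP.≤-trans (NP.<⇒≤ q) p)) (λ e → NP.<⇒≱ q (subst (N._≤ c) (sym e) r))) (hyp (here refl))))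

shiftUnder : ∀ {m} → Formula (suc m) → Formula (suc (suc m))
shiftUnder χ = renF (liftR suc) χ

shiftUnder-var : ∀ {m} (χ : Formula (suc m)) → (shiftUnder χ) [ var zero ] ≡ χ
shiftUnder-var χ = trans (subF-renF (single (var zero)) (liftR suc) χ)
  (trans (subF-cong (λ { zero → refl ; (suc i) → refl }) χ) (trans (subF-var id χ) (renF-id χ)))

shiftUnder-num : ∀ {m} (χ : Formula (suc m)) c → (shiftUnder χ) [ num c ] ≡ wkF (χ [ num c ])
shiftUnder-num χ c = trans (subF-renF (single (num c)) (liftR suc) χ)
  (trans (subF-cong (λ { zero → sym (renT-num suc c) ; (suc i) → refl }) χ) (sym (renF-subF suc (single (num c)) χ)))

bounded∀-intro : ∀ {T m} {Γ : List (Formula m)} {s} (χ : Formula (suc m)) → NumeralFacts T Γ s → ∀ a → a N.≤ s →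
       (∀ c → c N.≤ a → T ⨾ Γ ⊢ χ [ num c ]) → T ⨾ Γ ⊢ ∀' ((var zero ≼ num a) ⇒ χ)
bounded∀-intro χ F a p P = ∀I (⇒I (disj-cases a (≼-num⇒disj F' a p (hyp (here refl)))
   (λ c q → ≐-rewrite (shiftUnder χ) (≐sym (hyp (here refl))) (shiftUnder-num χ c) (shiftUnder-var χ)
               (⊢-rename suc (λ x → there (there (∈-map⁺ wkF x))) (P c q)))))
  where F' = NumeralFacts-rename suc (λ x → there (∈-map⁺ wkF x)) F

bounded∃-intro : ∀ {T m} {Γ : List (Formula m)} {s} (χ : Formula (suc m)) → NumeralFacts T Γ s → ∀ a c → c N.≤ a → a N.≤ s →
      T ⨾ Γ ⊢ χ [ num c ] → T ⨾ Γ ⊢ ∃' ((var zero ≼ num a) ∧ χ)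
bounded∃-intro χ F a c p q d = ∃I (num c) (∧I (cast (cong (num c ≼_) (sym (subT-num (single (num c)) a))) (num≤ F c a p q)) d)

bounded∀-refute : ∀ {T m} {Γ : List (Formula m)} {s} (χ : Formula (suc m)) → NumeralFacts T Γ s → ∀ a c → c N.≤ a → a N.≤ s →
      T ⨾ Γ ⊢ ¬' (χ [ num c ]) → T ⨾ Γ ⊢ ¬' (∀' ((var zero ≼ num a) ⇒ χ))
bounded∀-refute χ F a c p q d = ⇒I (⇒E (⊢-weaken there d)
  (⇒E (cast (cong (λ z → (num c ≼ z) ⇒ χ [ num c ]) (subT-num (single (num c)) a)) (∀E (hyp (here refl)) (num c)))
      (num≤ (NumeralFacts-weaken there F) c a p q)))

bounded∃-refute : ∀ {T m} {Γ : List (Formula m)} {s} (χ : Formula (suc m)) → NumeralFacts T Γ s → ∀ a → a N.≤ s →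
       (∀ c → c N.≤ a → T ⨾ Γ ⊢ ¬' (χ [ num c ])) → T ⨾ Γ ⊢ ¬' (∃' ((var zero ≼ num a) ∧ χ))
bounded∃-refute χ F a p N = ⇒I (∃E (hyp (here refl)) (disj-cases a (≼-num⇒disj F' a p (∧E₁ (hyp (here refl))))
  (λ c q → ⇒E (⊢-rename suc (λ x → there (there (∈-map⁺ wkF (there x)))) (N c q))
              (≐-rewrite (shiftUnder χ) (hyp (here refl)) (shiftUnder-var χ) (shiftUnder-num χ c) (∧E₂ (hyp (there (here refl))))))))
  where F' = NumeralFacts-rename suc (λ x → there (∈-map⁺ wkF (there x))) F

Decides : ∀ {T m} (Γ : List (Formula m)) → Set → Formula m → Set₁
Decides {T} Γ S A = (S × (T ⨾ Γ ⊢ A)) ⊎ ((¬ S) × (T ⨾ Γ ⊢ ¬' A))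

≤suc-split : ∀ {ℓ} {A : ℕ → Set ℓ} {a} → (∀ c → c N.≤ a → A c) → A (suc a) → ∀ c → c N.≤ suc a → A c
≤suc-split g x c p with NP.m≤n⇒m<n∨m≡n p
... | inj₁ q = g c (NP.≤-pred q)
... | inj₂ refl = x

bounded-search : ∀ {ℓ₁ ℓ₂} {A : ℕ → Set ℓ₁} {B : ℕ → Set ℓ₂} (a : ℕ) → (∀ c → c N.≤ a → A c ⊎ B c) →
         (∀ c → c N.≤ a → A c) ⊎ Σ ℕ (λ c → c N.≤ a × B c)
bounded-search zero f with f zero z≤n
... | inj₁ x = inj₁ (λ { zero z≤n → x })
... | inj₂ y = inj₂ (zero , z≤n , y)
bounded-search (suc a) f with bounded-search a (λ c p → f c (NP.m≤n⇒m≤1+n p))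
... | inj₂ (c , p , y) = inj₂ (c , NP.m≤n⇒m≤1+n p , y)
... | inj₁ g with f (suc a) NP.≤-refl
...   | inj₂ y = inj₂ (suc a , NP.≤-refl , y)
...   | inj₁ x = inj₁ (≤suc-split g x)

decideAtom : ∀ {T k m} {Γ : List (Formula m)} {s} (A : Atom k) (ρ : Fin k → ℕ) → (∀ i → ρ i N.≤ s) →
          NumeralFacts T Γ s → Decides {T} Γ (SatAtom ρ A) (atomFormula A (num ∘ ρ))
decideAtom (eqV i j) ρ B F with ρ i N.≟ ρ j
... | yes p = inj₁ (p , cast (cong (λ z → num (ρ i) ≐ num z) p) (≐refl _))
... | no np = inj₂ (np , num≢ F (ρ i) (ρ j) (B i) (B j) np)
decideAtom (eqZ i) ρ B F with ρ i N.≟ 0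
... | yes p = inj₁ (p , cast (cong (λ z → num (ρ i) ≐ num z) p) (≐refl _))
... | no np = inj₂ (np , num≢ F (ρ i) 0 (B i) z≤n np)
decideAtom (eqS i j) ρ B F with ρ i N.≟ suc (ρ j)
... | yes p = inj₁ (p , cast (cong (λ z → num (ρ i) ≐ num z) p) (≐refl _))
... | no np = inj₂ (np , num≢S F (ρ i) (ρ j) (B i) (B j) np)
decideAtom (eqP i j l) ρ B F with ρ i N.≟ ρ j N.+ ρ l
... | yes p = inj₁ (p , cast (cong (λ z → num z ≐ num (ρ j) ⊕ num (ρ l)) (sym p))
                      (≐sym (num+ F (ρ j) (ρ l) (subst (N._≤ _) p (B i)))))
... | no np = inj₂ (np , num+≢ F (ρ i) (ρ j) (ρ l) (B i) (B j) (B l) np)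
decideAtom (eqT i j l) ρ B F with ρ i N.≟ ρ j N.* ρ l
... | yes p = inj₁ (p , cast (cong (λ z → num z ≐ num (ρ j) ⊗ num (ρ l)) (sym p))
                      (≐sym (num* F (ρ j) (ρ l) (B j) (B l) (subst (N._≤ _) p (B i)))))
... | no np = inj₂ (np , num*≢ F (ρ i) (ρ j) (ρ l) (B i) (B j) (B l) np)
decideAtom (leV i j) ρ B F with ρ i N.≤? ρ j
... | yes p = inj₁ (p , num≤ F (ρ i) (ρ j) p (B j))
... | no np = inj₂ (np , num≰-refute F (ρ i) (ρ j) (B i) (NP.≰⇒> np))

consT-num : ∀ {k m} (ρ : Fin k → ℕ) c → consT {m = m} (num c) (num ∘ ρ) ≗ num ∘ extend ρ c
consT-num ρ c zero = refl
consT-num ρ c (suc i) = refl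

toFormula-inst-num : ∀ {k m} (ψ : Flat (suc k)) (ρ : Fin k → ℕ) c →
         (toFormula {m = suc m} ψ (liftS (num ∘ ρ))) [ num c ] ≡ toFormula ψ (num ∘ extend ρ c)
toFormula-inst-num ψ ρ c = trans (toFormula-inst ψ (num c) (num ∘ ρ)) (toFormula-cong ψ (consT-num ρ c))

extend-bounded : ∀ {k s} (ρ : Fin k → ℕ) c → (∀ i → ρ i N.≤ s) → c N.≤ s → ∀ i → extend ρ c i N.≤ s
extend-bounded ρ c B p zero = p
extend-bounded ρ c B p (suc i) = B i

decideFlat : ∀ {T k m} {Γ : List (Formula m)} {s} (φ : Flat k) (ρ : Fin k → ℕ) → (∀ i → ρ i N.≤ s) →
         NumeralFacts T Γ s → Decides {T} Γ (SatFlat ρ φ) (toFormula φ (num ∘ ρ))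
decideFlat ttF ρ B F = inj₁ (tt , ⇒I (hyp (here refl)))
decideFlat ffF ρ B F = inj₂ ((λ ()) , ⇒I (hyp (here refl)))
decideFlat (pos A) ρ B F = decideAtom A ρ B F
decideFlat (neg A) ρ B F with decideAtom A ρ B F
... | inj₁ (p , d) = inj₂ ((λ np → np p) , ⇒I (⇒E (hyp (here refl)) (⊢-weaken there d)))
... | inj₂ (np , d) = inj₁ (np , d)
decideFlat (φ ∧F ψ) ρ B F with decideFlat φ ρ B F | decideFlat ψ ρ B F
... | inj₁ (p , d) | inj₁ (q , e) = inj₁ ((p , q) , ∧I d e)
... | inj₂ (np , d) | _ = inj₂ ((λ x → np (proj₁ x)) , ⇒I (⇒E (⊢-weaken there d) (∧E₁ (hyp (here refl)))))
... | inj₁ _ | inj₂ (nq , e) = inj₂ ((λ x → nq (proj₂ x)) , ⇒I (⇒E (⊢-weaken there e) (∧E₂ (hyp (here refl)))))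
decideFlat (φ ∨F ψ) ρ B F with decideFlat φ ρ B F | decideFlat ψ ρ B F
... | inj₁ (p , d) | _ = inj₁ (inj₁ p , ∨I₁ d)
... | inj₂ _ | inj₁ (q , e) = inj₁ (inj₂ q , ∨I₂ e)
... | inj₂ (np , d) | inj₂ (nq , e) =
  inj₂ ((λ { (inj₁ x) → np x ; (inj₂ y) → nq y }) ,
        ⇒I (∨E (hyp (here refl)) (⇒E (⊢-weaken (λ x → there (there x)) d) (hyp (here refl)))
                                  (⇒E (⊢-weaken (λ x → there (there x)) e) (hyp (here refl)))))
decideFlat {s = s} (∀F i ψ) ρ B F with bounded-search (ρ i) (λ c p → decideFlat ψ (extend ρ c) (extend-bounded ρ c B (NP.≤-trans p (B i))) F)
... | inj₁ g = inj₁ ((λ c p → proj₁ (g c p)) ,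
       cast (cong (λ z → ∀' ((var zero ≼ z) ⇒ _)) (sym (wkT-num (ρ i))))
         (bounded∀-intro (toFormula ψ (liftS (num ∘ ρ))) F (ρ i) (B i) (λ c p → cast (sym (toFormula-inst-num ψ ρ c)) (proj₂ (g c p)))))
... | inj₂ (c , p , (np , d)) = inj₂ ((λ h → np (h c p)) ,
       cast (cong (λ z → ¬' (∀' ((var zero ≼ z) ⇒ _))) (sym (wkT-num (ρ i))))
         (bounded∀-refute (toFormula ψ (liftS (num ∘ ρ))) F (ρ i) c p (B i) (cast (cong ¬' (sym (toFormula-inst-num ψ ρ c))) d)))
decideFlat {s = s} (∃F i ψ) ρ B F with bounded-search (ρ i) (λ c p → Data.Sum.swap (decideFlat ψ (extend ρ c) (extend-bounded ρ c B (NP.≤-trans p (B i))) F))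
... | inj₁ g = inj₂ ((λ { (c , p , h) → proj₁ (g c p) h }) ,
       cast (cong (λ z → ¬' (∃' ((var zero ≼ z) ∧ _))) (sym (wkT-num (ρ i))))
         (bounded∃-refute (toFormula ψ (liftS (num ∘ ρ))) F (ρ i) (B i) (λ c p → cast (cong ¬' (sym (toFormula-inst-num ψ ρ c))) (proj₂ (g c p)))))
... | inj₂ (c , p , (h , d)) = inj₁ ((c , p , h) ,
       cast (cong (λ z → ∃' ((var zero ≼ z) ∧ _)) (sym (wkT-num (ρ i))))
         (bounded∃-intro (toFormula ψ (liftS (num ∘ ρ))) F (ρ i) c p (B i) (cast (sym (toFormula-inst-num ψ ρ c)) d)))

fromFin0 : ∀ {m} → Fin 0 → Fin m
fromFin0 ()

R₀-numeralFacts : ∀ {m} {Γ : List (Formula m)} s → NumeralFacts R₀ Γ s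
R₀-numeralFacts s = record
  { num≢ = λ a c _ _ ne → cast (cong₂ (λ u v → ¬' (u ≐ v)) (renT-num _ a) (renT-num _ c)) (ax (R₀≠ a c ne))
  ; num≢S = λ a c _ _ ne → cast (cong₂ (λ u v → ¬' (u ≐ v)) (renT-num _ a) (renT-num _ (suc c))) (ax (R₀≠ a (suc c) ne))
  ; num+ = λ a c _ → plus a c
  ; num+≢ = λ k a c _ _ _ ne → ⇒I (⇒E (cast (cong₂ (λ u v → ¬' (u ≐ v)) (renT-num _ k) (renT-num _ (a N.+ c))) (ax (R₀≠ k (a N.+ c) ne)))
                                          (≐trans (hyp (here refl)) (plus a c)))
  ; num* = λ a c _ _ _ → times a c
  ; num*≢ = λ k a c _ _ _ ne → ⇒I (⇒E (cast (cong₂ (λ u v → ¬' (u ≐ v)) (renT-num _ k) (renT-num _ (a N.* c))) (ax (R₀≠ k (a N.* c) ne)))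
                                          (≐trans (hyp (here refl)) (times a c)))
  ; num≤ = λ a c p _ → cast (cong₂ _≼_ (renT-num _ a) (renT-num _ c)) (ax (R₀≼ a c p))
  ; num-R₀≤ = λ a _ → cast (renF-R₀≤-axiom _ a) (ax (R₀≤ a)) }
  where
    plus : ∀ {m} {Γ : List (Formula m)} a c → R₀ ⨾ Γ ⊢ num a ⊕ num c ≐ num (a N.+ c)
    plus a c = cast (cong₂ _≐_ (cong₂ _⊕_ (renT-num _ a) (renT-num _ c)) (renT-num _ (a N.+ c))) (ax (R₀+ a c))
    times : ∀ {m} {Γ : List (Formula m)} a c → R₀ ⨾ Γ ⊢ num a ⊗ num c ≐ num (a N.* c)
    times a c = cast (cong₂ _≐_ (cong₂ _⊗_ (renT-num _ a) (renT-num _ c)) (renT-num _ (a N.* c))) (ax (R₀× a c))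

-- The body of a law refers to its bound variables in de Bruijn order: f0 is the
-- innermost one, and the largest index is the parameter b of Φ(b).

f0 : ∀ {n} → Fin (suc n)
f0 = zero
f1 : ∀ {n} → Fin (suc (suc n))
f1 = suc zero
f2 : ∀ {n} → Fin (suc (suc (suc n)))
f2 = suc f1
f3 : ∀ {n} → Fin (suc (suc (suc (suc n))))
f3 = suc f2
f4 : ∀ {n} → Fin (suc (suc (suc (suc (suc n)))))
f4 = suc f3

law-zero law-suc-or-top law-plus-zero law-plus-suc law-times-zero law-times-suc law-suc≢zero
  law-suc-injective law-zero-≤ law-suc-mono-≤ law-≤-suc-cases law-≤-zero-cases law-plus-suc≢zero
  law-plus-suc-pred law-times-suc-split : Flat 1
law-zero = ∃F f0 (pos (eqZ f0))
law-suc-or-top = ∀F f0 (pos (eqV f0 f1) ∨F ∃F f1 (pos (eqS f0 f1)))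
law-plus-zero = ∀F f0 (∀F f1 (neg (eqZ f0) ∨F pos (eqP f1 f1 f0)))
law-plus-suc = ∀F f0 (∀F f1 (∀F f2 (∀F f3 (∀F f4
  (neg (eqS f2 f3) ∨F neg (eqS f0 f1) ∨F neg (eqP f1 f4 f3) ∨F pos (eqP f0 f4 f2))))))
law-times-zero = ∀F f0 (∀F f1 (neg (eqZ f0) ∨F pos (eqT f0 f1 f0)))
law-times-suc = ∀F f0 (∀F f1 (∀F f2 (∀F f3 (∀F f4
  (neg (eqS f2 f3) ∨F neg (eqT f1 f4 f3) ∨F neg (eqP f0 f1 f4) ∨F pos (eqT f0 f4 f2))))))
law-suc≢zero = ∀F f0 (∀F f1 (neg (eqS f0 f1) ∨F neg (eqZ f0)))
law-suc-injective = ∀F f0 (∀F f1 (∀F f2 (neg (eqS f2 f1) ∨F neg (eqS f2 f0) ∨F pos (eqV f1 f0))))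
law-zero-≤ = ∀F f0 (∀F f1 (neg (eqZ f0) ∨F pos (leV f0 f1)))
law-suc-mono-≤ = ∀F f0 (∀F f1 (∀F f2 (∀F f3
  (neg (eqS f1 f3) ∨F neg (eqS f0 f2) ∨F neg (leV f3 f2) ∨F pos (leV f1 f0)))))
law-≤-suc-cases = ∀F f0 (∀F f1 (∀F f1 (neg (eqS f2 f1) ∨F pos (eqV f0 f2) ∨F pos (leV f0 f1))))
law-≤-zero-cases = ∀F f0 (∀F f0 (neg (eqZ f1) ∨F pos (eqV f0 f1)))
law-plus-suc≢zero = ∀F f0 (∀F f1 (∀F f2 (∀F f3
  (neg (eqS f1 f2) ∨F neg (eqP f0 f3 f1) ∨F neg (eqZ f0)))))
law-plus-suc-pred = ∀F f0 (∀F f1 (∀F f2 (∀F f3 (∀F f4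
  (neg (eqS f2 f3) ∨F neg (eqS f0 f1) ∨F neg (eqP f0 f4 f2) ∨F pos (eqP f1 f4 f3))))))
law-times-suc-split = ∀F f0 (∀F f1 (∀F f2 (∀F f3
  (neg (eqS f1 f2) ∨F neg (eqT f0 f3 f1) ∨F ∃F f0 (pos (eqT f0 f4 f3) ∧F pos (eqP f1 f0 f4))))))

⋀ : ∀ {k} → List (Flat k) → Flat k
⋀ []       = ttF
⋀ (φ ∷ φs) = φ ∧F ⋀ φs

⋀-lookup : ∀ {T k m} {Γ : List (Formula m)} (φs : List (Flat k)) {τ} (i : Fin (length φs)) →
           T ⨾ Γ ⊢ toFormula (⋀ φs) τ → T ⨾ Γ ⊢ toFormula (lookup φs i) τ
⋀-lookup (φ ∷ φs) zero    d = ∧E₁ d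
⋀-lookup (φ ∷ φs) (suc i) d = ⋀-lookup φs i (∧E₂ d)

laws : List (Flat 1)
laws = law-zero ∷ law-suc-or-top ∷ law-plus-zero ∷ law-plus-suc ∷ law-times-zero ∷ law-times-suc ∷
       law-suc≢zero ∷ law-suc-injective ∷ law-zero-≤ ∷ law-suc-mono-≤ ∷ law-≤-suc-cases ∷
       law-≤-zero-cases ∷ law-plus-suc≢zero ∷ law-plus-suc-pred ∷ law-times-suc-split ∷ []

Φ : Flat 1
Φ = ⋀ laws

dec-implication : ∀ {P Q : Set} → Dec P → (P → Q) → (¬ P) ⊎ Q
dec-implication (yes p) f = inj₂ (f p)
dec-implication (no np) f = inj₁ np

Φ-valid : ∀ ρ → SatFlat ρ Φ
Φ-valid ρ = (0 , z≤n , refl) , suc-or-top , plus-zero , plus-suc , times-zero , times-suc , suc≢zero ,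
            suc-injective , zero-≤ , suc-mono-≤ , ≤-suc-cases , ≤-zero-cases , plus-suc≢zero ,
            plus-suc-pred , times-suc-split , tt
  where
    suc-or-top : SatFlat ρ law-suc-or-top
    suc-or-top y p with NP.m≤n⇒m<n∨m≡n p
    ... | inj₁ q = inj₂ (suc y , q , refl)
    ... | inj₂ e = inj₁ e
    plus-zero : SatFlat ρ law-plus-zero
    plus-zero u _ z _ = dec-implication (z N.≟ 0) (λ { refl → sym (NP.+-identityʳ u) })
    plus-suc : SatFlat ρ law-plus-suc
    plus-suc u _ v _ v' _ w _ w' _ = dec-implication (v' N.≟ suc v) λ { refl → dec-implication (w' N.≟ suc w) λ { refl →
      dec-implication (w N.≟ u N.+ v) λ { refl → sym (NP.+-suc u v) } } }
    times-zero : SatFlat ρ law-times-zero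
    times-zero u _ z _ = dec-implication (z N.≟ 0) (λ { refl → sym (NP.*-zeroʳ u) })
    times-suc : SatFlat ρ law-times-suc
    times-suc u _ v _ v' _ w _ w' _ = dec-implication (v' N.≟ suc v) λ { refl → dec-implication (w N.≟ u N.* v) λ { refl →
      dec-implication (w' N.≟ u N.* v N.+ u) λ { refl → trans (NP.+-comm (u N.* v) u) (sym (NP.*-suc u v)) } } }
    suc≢zero : SatFlat ρ law-suc≢zero
    suc≢zero v _ w _ = dec-implication (w N.≟ suc v) (λ { refl () })
    suc-injective : SatFlat ρ law-suc-injective
    suc-injective w _ v _ v' _ = dec-implication (w N.≟ suc v) λ { refl → dec-implication (suc v N.≟ suc v') NP.suc-injective }
    zero-≤ : SatFlat ρ law-zero-≤
    zero-≤ u _ z _ = dec-implication (z N.≟ 0) (λ { refl → z≤n })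
    suc-mono-≤ : SatFlat ρ law-suc-mono-≤
    suc-mono-≤ u _ v _ u' _ v' _ = dec-implication (u' N.≟ suc u) λ { refl → dec-implication (v' N.≟ suc v) λ { refl →
      dec-implication (u N.≤? v) s≤s } }
    ≤-suc-cases : SatFlat ρ law-≤-suc-cases
    ≤-suc-cases u _ v _ z q = dec-implication (u N.≟ suc v) λ { refl → Data.Sum.swap (≤suc-cases q) }
      where
        ≤suc-cases : ∀ {z} → z N.≤ suc v → (z N.≤ v) ⊎ (z ≡ suc v)
        ≤suc-cases q = Data.Sum.map₁ NP.≤-pred (NP.m≤n⇒m<n∨m≡n q)
    ≤-zero-cases : SatFlat ρ law-≤-zero-cases
    ≤-zero-cases u _ z q = dec-implication (u N.≟ 0) λ { refl → NP.n≤0⇒n≡0 q }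
    plus-suc≢zero : SatFlat ρ law-plus-suc≢zero
    plus-suc≢zero u _ v _ v' _ w _ = dec-implication (v' N.≟ suc v) λ { refl → dec-implication (w N.≟ u N.+ suc v) λ { refl →
      λ e → subst (λ z → z ≢ 0) (sym (NP.+-suc u v)) (λ ()) e } }
    plus-suc-pred : SatFlat ρ law-plus-suc-pred
    plus-suc-pred u _ v _ v' _ w _ w' _ = dec-implication (v' N.≟ suc v) λ { refl → dec-implication (w' N.≟ suc w) λ { refl →
      dec-implication (suc w N.≟ u N.+ suc v) λ e → NP.suc-injective (trans e (NP.+-suc u v)) } }
    times-suc-split : SatFlat ρ law-times-suc-split
    times-suc-split u _ v _ v' _ w _ = dec-implication (v' N.≟ suc v) λ { refl → dec-implication (w N.≟ u N.* suc v) λ { refl →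
      u N.* v , subst (u N.* v N.≤_) (trans (NP.+-comm (u N.* v) u) (sym (NP.*-suc u v))) (NP.m≤m+n (u N.* v) u) ,
      refl , trans (NP.*-suc u v) (NP.+-comm u (u N.* v)) } }

record LawsBelow (T : Theory) (X : Flat 1) {m} (Γ : List (Formula m)) (B : Term m) (s : ℕ) : Set₁ where
  field
    lawsHold : T ⨾ Γ ⊢ toFormula (Φ ∧F X) (λ _ → B)
    numeralsBelow : ∀ a → a N.≤ s → T ⨾ Γ ⊢ num a ≼ B
open LawsBelow public

LawsBelow-weaken : ∀ {T X m} {Γ Δ : List (Formula m)} {B s} → Γ ⊆ Δ → LawsBelow T X Γ B s → LawsBelow T X Δ B s
LawsBelow-weaken h L = record { lawsHold = ⊢-weaken h (lawsHold L) ; numeralsBelow = λ a p → ⊢-weaken h (numeralsBelow L a p) }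

LawsBelow-rename : ∀ {T X n m} {Γ : List (Formula n)} {Δ : List (Formula m)} {B s} (r : Fin n → Fin m) →
       Γ ⊆[ r ] Δ → LawsBelow T X Γ B s → LawsBelow T X Δ (renT r B) s
LawsBelow-rename {X = X} {B = B} r h L = record
  { lawsHold = cast (toFormula-rename (Φ ∧F X) r (λ _ → B)) (⊢-rename r h (lawsHold L))
  ; numeralsBelow = λ a p → cast (cong (_≼ renT r B) (renT-num r a)) (⊢-rename r h (numeralsBelow L a p)) }

Instances : ∀ {k m} (T : Theory) (Γ : List (Formula m)) → Flat k → (Fin k → Term m) → Set₁
Instances {m = m} T Γ (∀F i φ) τ = (u : Term m) → T ⨾ Γ ⊢ u ≼ τ i → Instances T Γ φ (consT u τ)
Instances T Γ φ τ = T ⨾ Γ ⊢ toFormula φ τ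

instantiate : ∀ {T k m} {Γ : List (Formula m)} (φ : Flat k) (τ : Fin k → Term m) →
              T ⨾ Γ ⊢ toFormula φ τ → Instances T Γ φ τ
instantiate (∀F i φ) τ d = λ u p → instantiate φ (consT u τ) (∀F-elim {i = i} {φ = φ} {τ = τ} d u p)
instantiate ttF      τ d = d
instantiate ffF      τ d = d
instantiate (pos A)  τ d = d
instantiate (neg A)  τ d = d
instantiate (φ ∧F ψ) τ d = d
instantiate (φ ∨F ψ) τ d = d
instantiate (∃F i φ) τ d = d

module Laws {T : Theory} {X : Flat 1} {m} {Γ : List (Formula m)} {B : Term m} {s : ℕ} (L : LawsBelow T X Γ B s) where
  private
    law : (i : Fin (length laws)) → Instances T Γ (lookup laws i) (λ _ → B)
    law i = instantiate (lookup laws i) (λ _ → B) (⋀-lookup laws i (∧E₁ (lawsHold L)))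
    bd : ∀ {a} → a N.≤ s → T ⨾ Γ ⊢ num a ≼ B
    bd {a} = numeralsBelow L a

  suc-or-top : ∀ a → a N.≤ s → T ⨾ Γ ⊢ (num a ≐ B) ∨ ∃≤ B (var zero ≐ `S (wkT (num a)))
  suc-or-top a pa = law (# 1) (num a) (bd pa)

  plus-zero : ∀ u z → u N.≤ s → z N.≤ s → T ⨾ Γ ⊢ ¬' (num z ≐ `0) ∨ (num u ≐ num u ⊕ num z)
  plus-zero u z pu pz = law (# 2) (num u) (bd pu) (num z) (bd pz)

  plus-suc : ∀ u v v' w w' → u N.≤ s → v N.≤ s → v' N.≤ s → w N.≤ s → w' N.≤ s →
        T ⨾ Γ ⊢ ¬' (num v' ≐ `S (num v)) ∨ ¬' (num w' ≐ `S (num w)) ∨ ¬' (num w ≐ num u ⊕ num v) ∨ (num w' ≐ num u ⊕ num v')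
  plus-suc u v v' w w' pu pv pv' pw pw' =
    law (# 3) (num u) (bd pu) (num v) (bd pv) (num v') (bd pv') (num w) (bd pw) (num w') (bd pw')

  times-zero : ∀ u z → u N.≤ s → z N.≤ s → T ⨾ Γ ⊢ ¬' (num z ≐ `0) ∨ (num z ≐ num u ⊗ num z)
  times-zero u z pu pz = law (# 4) (num u) (bd pu) (num z) (bd pz)

  times-suc : ∀ u v v' w w' → u N.≤ s → v N.≤ s → v' N.≤ s → w N.≤ s → w' N.≤ s →
        T ⨾ Γ ⊢ ¬' (num v' ≐ `S (num v)) ∨ ¬' (num w ≐ num u ⊗ num v) ∨ ¬' (num w' ≐ num w ⊕ num u) ∨ (num w' ≐ num u ⊗ num v')
  times-suc u v v' w w' pu pv pv' pw pw' =
    law (# 5) (num u) (bd pu) (num v) (bd pv) (num v') (bd pv') (num w) (bd pw) (num w') (bd pw')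

  suc≢zero : ∀ v w → v N.≤ s → w N.≤ s → T ⨾ Γ ⊢ ¬' (num w ≐ `S (num v)) ∨ ¬' (num w ≐ `0)
  suc≢zero v w pv pw = law (# 6) (num v) (bd pv) (num w) (bd pw)

  suc-injective : ∀ w v v' → w N.≤ s → v N.≤ s → v' N.≤ s →
        T ⨾ Γ ⊢ ¬' (num w ≐ `S (num v)) ∨ ¬' (num w ≐ `S (num v')) ∨ (num v ≐ num v')
  suc-injective w v v' pw pv pv' = law (# 7) (num w) (bd pw) (num v) (bd pv) (num v') (bd pv')

  zero-≤ : ∀ u z → u N.≤ s → z N.≤ s → T ⨾ Γ ⊢ ¬' (num z ≐ `0) ∨ (num z ≼ num u)
  zero-≤ u z pu pz = law (# 8) (num u) (bd pu) (num z) (bd pz)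

  suc-mono-≤ : ∀ u v u' v' → u N.≤ s → v N.≤ s → u' N.≤ s → v' N.≤ s →
        T ⨾ Γ ⊢ ¬' (num u' ≐ `S (num u)) ∨ ¬' (num v' ≐ `S (num v)) ∨ ¬' (num u ≼ num v) ∨ (num u' ≼ num v')
  suc-mono-≤ u v u' v' pu pv pu' pv' = law (# 9) (num u) (bd pu) (num v) (bd pv) (num u') (bd pu') (num v') (bd pv')

  ≤-suc-cases : ∀ u v (z : Term m) → u N.≤ s → v N.≤ s → T ⨾ Γ ⊢ z ≼ num u →
       T ⨾ Γ ⊢ ¬' (num u ≐ `S (num v)) ∨ (z ≐ num u) ∨ (z ≼ num v)
  ≤-suc-cases u v z pu pv pz = law (# 10) (num u) (bd pu) (num v) (bd pv) z pz

  ≤-zero-cases : ∀ u (z : Term m) → u N.≤ s → T ⨾ Γ ⊢ z ≼ num u → T ⨾ Γ ⊢ ¬' (num u ≐ `0) ∨ (z ≐ num u)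
  ≤-zero-cases u z pu pz = law (# 11) (num u) (bd pu) z pz

  plus-suc≢zero : ∀ u v v' w → u N.≤ s → v N.≤ s → v' N.≤ s → w N.≤ s →
         T ⨾ Γ ⊢ ¬' (num v' ≐ `S (num v)) ∨ ¬' (num w ≐ num u ⊕ num v') ∨ ¬' (num w ≐ `0)
  plus-suc≢zero u v v' w pu pv pv' pw = law (# 12) (num u) (bd pu) (num v) (bd pv) (num v') (bd pv') (num w) (bd pw)

  plus-suc-pred : ∀ u v v' w w' → u N.≤ s → v N.≤ s → v' N.≤ s → w N.≤ s → w' N.≤ s →
        T ⨾ Γ ⊢ ¬' (num v' ≐ `S (num v)) ∨ ¬' (num w' ≐ `S (num w)) ∨ ¬' (num w' ≐ num u ⊕ num v') ∨ (num w ≐ num u ⊕ num v)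
  plus-suc-pred u v v' w w' pu pv pv' pw pw' =
    law (# 13) (num u) (bd pu) (num v) (bd pv) (num v') (bd pv') (num w) (bd pw) (num w') (bd pw')

  times-suc-split : ∀ u v v' w → u N.≤ s → v N.≤ s → v' N.≤ s → w N.≤ s →
         T ⨾ Γ ⊢ ¬' (num v' ≐ `S (num v)) ∨ ¬' (num w ≐ num u ⊗ num v') ∨
                 ∃≤ (num w) ((var zero ≐ wkT (num u) ⊗ wkT (num v)) ∧ (wkT (num w) ≐ var zero ⊕ wkT (num u)))
  times-suc-split u v v' w pu pv pv' pw = law (# 14) (num u) (bd pu) (num v) (bd pv) (num v') (bd pv') (num w) (bd pw)

∨-resolve : ∀ {T m} {Γ : List (Formula m)} {A R} → T ⨾ Γ ⊢ ¬' A ∨ R → T ⨾ Γ ⊢ A → T ⨾ Γ ⊢ R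
∨-resolve d a = ∨E d (⊢-explode (⇒E (hyp (here refl)) (⊢-weaken there a))) (hyp (here refl))

+suc-≤ : ∀ {a c s} → a N.+ suc c N.≤ s → a N.+ c N.≤ s
+suc-≤ {a} {c} p = NP.≤-trans (NP.+-monoʳ-≤ a (NP.n≤1+n c)) p

disj-var : ∀ {n} a → disj {n} a ≡ disjOf (var zero) a
disj-var zero = refl
disj-var (suc a) = cong (_∨ (var zero ≐ num (suc a))) (disj-var a)

module _ {T : Theory} {X : Flat 1} where

  laws-plus : ∀ {m} {Γ : List (Formula m)} {B s} → LawsBelow T X Γ B s → ∀ a c → a N.+ c N.≤ s → T ⨾ Γ ⊢ num a ⊕ num c ≐ num (a N.+ c)
  laws-plus L a zero p = cast (cong (λ z → num a ⊕ num 0 ≐ num z) (sym (NP.+-identityʳ a)))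
    (≐sym (∨-resolve (plus-zero a 0 (NP.m+n≤o⇒m≤o _ p) z≤n) (≐refl _)))
    where open Laws L
  laws-plus L a (suc c) p = ≐sym (∨-resolve (∨-resolve (∨-resolve (plus-suc a c (suc c) (a N.+ c) (a N.+ suc c) (NP.m+n≤o⇒m≤o _ p) (NP.<⇒≤ (NP.m+n≤o⇒n≤o _ p)) (NP.m+n≤o⇒n≤o _ p) (+suc-≤ p) p)
      (≐refl _)) (cast (cong (λ z → num (a N.+ suc c) ≐ num z) (NP.+-suc a c)) (≐refl _))) (≐sym (laws-plus L a c (+suc-≤ p))))
    where open Laws L

  laws-times : ∀ {m} {Γ : List (Formula m)} {B s} → LawsBelow T X Γ B s → ∀ a c → a N.≤ s → c N.≤ s → a N.* c N.≤ s →
           T ⨾ Γ ⊢ num a ⊗ num c ≐ num (a N.* c)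
  laws-times L a zero pa pc p = cast (cong (λ z → num a ⊗ num 0 ≐ num z) (sym (NP.*-zeroʳ a)))
    (≐sym (∨-resolve (times-zero a 0 pa z≤n) (≐refl _)))
    where open Laws L
  laws-times {s = s} L a (suc c) pa pc p =
    ≐sym (∨-resolve (∨-resolve (∨-resolve (times-suc a c (suc c) (a N.* c) (a N.* suc c) pa (NP.<⇒≤ pc) pc pac p) (≐refl _))
      (≐sym (laws-times L a c pa (NP.<⇒≤ pc) pac)))
      (cast (cong (λ z → num z ≐ num (a N.* c) ⊕ num a) (sym e)) (≐sym (laws-plus L (a N.* c) a (subst (N._≤ s) e p)))))
    where
      open Laws L
      e : a N.* suc c ≡ a N.* c N.+ a
      e = trans (NP.*-suc a c) (NP.+-comm a (a N.* c))
      pac : a N.* c N.≤ s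
      pac = NP.m+n≤o⇒m≤o _ (subst (N._≤ s) e p)

  laws-≢ : ∀ {m} {Γ : List (Formula m)} {B s} → LawsBelow T X Γ B s → ∀ a c → a N.≤ s → c N.≤ s → a ≢ c → T ⨾ Γ ⊢ ¬' (num a ≐ num c)
  laws-≢ L zero zero pa pc ne = ⊥-elim (ne refl)
  laws-≢ L zero (suc c) pa pc ne = ⇒I (⇒E (⊢-weaken there (∨-resolve (suc≢zero c (suc c) (NP.<⇒≤ pc) pc) (≐refl _))) (≐sym (hyp (here refl))))
    where open Laws L
  laws-≢ L (suc a) zero pa pc ne = ∨-resolve (suc≢zero a (suc a) (NP.<⇒≤ pa) pa) (≐refl _)
    where open Laws L
  laws-≢ L (suc a) (suc c) pa pc ne =
    ⇒I (⇒E (⊢-weaken there (laws-≢ L a c (NP.<⇒≤ pa) (NP.<⇒≤ pc) (λ e → ne (cong suc e))))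
          (∨-resolve (∨-resolve (⊢-weaken there (suc-injective (suc a) a c pa (NP.<⇒≤ pa) (NP.<⇒≤ pc))) (≐refl _)) (hyp (here refl))))
    where open Laws L

  laws-≢S : ∀ {m} {Γ : List (Formula m)} {B s} → LawsBelow T X Γ B s → ∀ a c → a N.≤ s → c N.≤ s → a ≢ suc c → T ⨾ Γ ⊢ ¬' (num a ≐ `S (num c))
  laws-≢S L zero c pa pc ne = ∨E (suc≢zero c 0 pc pa) (hyp (here refl)) (⊢-explode (⇒E (hyp (here refl)) (≐refl _)))
    where open Laws L
  laws-≢S L (suc a) c pa pc ne =
    ⇒I (⇒E (⊢-weaken there (laws-≢ L a c (NP.<⇒≤ pa) pc (λ e → ne (cong suc e))))
          (∨-resolve (∨-resolve (⊢-weaken there (suc-injective (suc a) a c pa (NP.<⇒≤ pa) pc)) (≐refl _)) (hyp (here refl))))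
    where open Laws L

  laws-≤ : ∀ {m} {Γ : List (Formula m)} {B s} → LawsBelow T X Γ B s → ∀ a c → a N.≤ c → c N.≤ s → T ⨾ Γ ⊢ num a ≼ num c
  laws-≤ L zero c p pc = ∨-resolve (zero-≤ c 0 pc z≤n) (≐refl _)
    where open Laws L
  laws-≤ L (suc a) (suc c) (s≤s p) pc =
    ∨-resolve (∨-resolve (∨-resolve (suc-mono-≤ a c (suc a) (suc c) (NP.≤-trans p (NP.<⇒≤ pc)) (NP.<⇒≤ pc) (NP.≤-trans (s≤s p) pc) pc) (≐refl _)) (≐refl _))
        (laws-≤ L a c p (NP.<⇒≤ pc))
    where open Laws L

  laws-disj : ∀ {m} {Γ : List (Formula m)} {B s} → LawsBelow T X Γ B s → (z : Term m) → ∀ a → a N.≤ s →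
          T ⨾ Γ ⊢ z ≼ num a → T ⨾ Γ ⊢ disjOf z a
  laws-disj L z zero p h = ∨-resolve (≤-zero-cases 0 z z≤n h) (≐refl _)
    where open Laws L
  laws-disj L z (suc a) p h =
    ∨E (∨-resolve (≤-suc-cases (suc a) a z p (NP.<⇒≤ p) h) (≐refl _)) (∨I₂ (hyp (here refl)))
       (∨I₁ (laws-disj (LawsBelow-weaken there L) z a (NP.<⇒≤ p) (hyp (here refl))))
    where open Laws L

  laws-R₀≤-axiom : ∀ {m} {Γ : List (Formula m)} {B s} → LawsBelow T X Γ B s → ∀ a → a N.≤ s → T ⨾ Γ ⊢ R₀≤-axiom a
  laws-R₀≤-axiom L a p = ∀I (⇒I (cast (sym (disj-var a))
    (laws-disj (LawsBelow-weaken there (LawsBelow-rename suc (λ x → ∈-map⁺ wkF x) L)) (var zero) a p (hyp (here refl)))))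

  laws-plus≢ : ∀ {m} {Γ : List (Formula m)} {B s} → LawsBelow T X Γ B s → ∀ k a c → k N.≤ s → a N.≤ s → c N.≤ s → k ≢ a N.+ c →
           T ⨾ Γ ⊢ ¬' (num k ≐ num a ⊕ num c)
  laws-plus≢ L k a zero pk pa pc ne =
    ⇒I (⇒E (⊢-weaken there (laws-≢ L k a pk pa (λ e → ne (trans e (sym (NP.+-identityʳ a))))))
          (≐trans (hyp (here refl)) (≐sym (∨-resolve (⊢-weaken there (plus-zero a 0 pa z≤n)) (≐refl _)))))
    where open Laws L
  laws-plus≢ L zero a (suc c) pk pa pc ne =
    ⇒I (⇒E (∨-resolve (∨-resolve (⊢-weaken there (plus-suc≢zero a c (suc c) 0 pa (NP.<⇒≤ pc) pc pk)) (≐refl _)) (hyp (here refl))) (≐refl _))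
    where open Laws L
  laws-plus≢ L (suc k) a (suc c) pk pa pc ne =
    ⇒I (⇒E (⊢-weaken there (laws-plus≢ L k a c (NP.<⇒≤ pk) pa (NP.<⇒≤ pc) (λ e → ne (trans (cong suc e) (sym (NP.+-suc a c))))))
          (∨-resolve (∨-resolve (∨-resolve (⊢-weaken there (plus-suc-pred a c (suc c) k (suc k) pa (NP.<⇒≤ pc) pc (NP.<⇒≤ pk) pk)) (≐refl _)) (≐refl _))
               (hyp (here refl))))
    where open Laws L

  laws-times≢ : ∀ {m} {Γ : List (Formula m)} {B s} → LawsBelow T X Γ B s → ∀ k a c → k N.≤ s → a N.≤ s → c N.≤ s → k ≢ a N.* c →
           T ⨾ Γ ⊢ ¬' (num k ≐ num a ⊗ num c)
  laws-times≢ L k a zero pk pa pc ne =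
    ⇒I (⇒E (⊢-weaken there (laws-≢ L k 0 pk z≤n (λ e → ne (trans e (sym (NP.*-zeroʳ a))))))
          (≐trans (hyp (here refl)) (≐sym (∨-resolve (⊢-weaken there (times-zero a 0 pa z≤n)) (≐refl _)))))
    where open Laws L
  laws-times≢ {m} {Γ} {B} {s} L k a (suc c) pk pa pc ne =
    ⇒I (∃E (∨-resolve (∨-resolve (⊢-weaken there (times-suc-split a c (suc c) k pa (NP.<⇒≤ pc) pc pk)) (≐refl _)) (hyp (here refl)))
      (disj-cases k (laws-disj (LawsBelow-rename suc (λ p → there (∈-map⁺ wkF (there p))) L) (var zero) k pk
                 (cast (cong (var zero ≼_) (wkT-num k)) (∧E₁ (hyp (here refl)))))
        (λ j pj → cases (LawsBelow-weaken there (LawsBelow-rename suc (λ p → there (∈-map⁺ wkF (there p))) L)) j pj (j N.≟ a N.* c)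
          (≐-rewrite (var zero ≐ num a ⊗ num c) (hyp (here refl)) (χ1 (var zero)) (χ1 (num j))
            (cast (cong₂ (λ x y → var zero ≐ x ⊗ y) (wkT-num a) (wkT-num c)) (∧E₁ (∧E₂ (hyp (there (here refl)))))))
          (≐-rewrite (num k ≐ var zero ⊕ num a) (hyp (here refl)) (χ2 (var zero)) (χ2 (num j))
            (cast (cong₂ (λ x y → x ≐ var zero ⊕ y) (wkT-num k) (wkT-num a)) (∧E₂ (∧E₂ (hyp (there (here refl))))))))))
    where
      open Laws L
      χ1 : ∀ {n} (t : Term n) → (var zero ≐ num a ⊗ num c) [ t ] ≡ (t ≐ num a ⊗ num c)
      χ1 t = cong₂ (λ x y → t ≐ x ⊗ y) (subT-num _ a) (subT-num _ c)
      χ2 : ∀ {n} (t : Term n) → (num k ≐ var zero ⊕ num a) [ t ] ≡ (num k ≐ t ⊕ num a)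
      χ2 t = cong₂ (λ x y → x ≐ t ⊕ y) (subT-num _ k) (subT-num _ a)
      cases : ∀ {n} {Δ : List (Formula n)} {B'} → LawsBelow T X Δ B' s → ∀ j → j N.≤ k → Dec (j ≡ a N.* c) →
              T ⨾ Δ ⊢ num j ≐ num a ⊗ num c → T ⨾ Δ ⊢ num k ≐ num j ⊕ num a → T ⨾ Δ ⊢ ⊥'
      cases L' j pj (yes e) G2 G3 = ⇒E (laws-plus≢ L' k j a pk (NP.≤-trans pj pk) pa
        (λ e' → ne (trans e' (trans (cong (N._+ a) e) (trans (NP.+-comm (a N.* c) a) (sym (NP.*-suc a c))))))) G3
      cases L' j pj (no ne2) G2 G3 = ⇒E (laws-times≢ L' j a c (NP.≤-trans pj pk) pa (NP.<⇒≤ pc) ne2) G2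

laws⇒numeralFacts : ∀ {T X m} {Γ : List (Formula m)} {B s} → LawsBelow T X Γ B s → NumeralFacts T Γ s
laws⇒numeralFacts L = record
  { num≢ = laws-≢ L ; num≢S = laws-≢S L ; num+ = laws-plus L ; num+≢ = laws-plus≢ L
  ; num* = laws-times L ; num*≢ = laws-times≢ L ; num≤ = laws-≤ L ; num-R₀≤ = laws-R₀≤-axiom L }

fsuc : ∀ {k} → Fin k → Fin (suc k)
fsuc = suc

fsuc² : ∀ {k} → Fin k → Fin (suc (suc k))
fsuc² i = suc (suc i)

-- evalInto t e bi w says that variable w holds the value of t, e places the
-- variables of t and every intermediate value is quantified below variable bi.
evalInto : ∀ {n k} → Term n → (Fin n → Fin k) → Fin k → Fin k → Flat k
evalPairInto : ∀ {n k} → Term n → Term n → (Fin n → Fin k) → Fin k → Flat (suc (suc k)) → Flat k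
evalInto (var i) e bi w = pos (eqV w (e i))
evalInto `0 e bi w = pos (eqZ w)
evalInto (`S t) e bi w = ∃F bi (evalInto t (fsuc ∘ e) (suc bi) zero ∧F pos (eqS (suc w) zero))
evalInto (s ⊕ t) e bi w = evalPairInto s t e bi (pos (eqP (suc (suc w)) f1 f0))
evalInto (s ⊗ t) e bi w = evalPairInto s t e bi (pos (eqT (suc (suc w)) f1 f0))
evalPairInto s t e bi A = ∃F bi (∃F (suc bi) ((evalInto s (fsuc² ∘ e) (suc (suc bi)) f1 ∧F evalInto t (fsuc² ∘ e) (suc (suc bi)) f0) ∧F A))

bindUnder : ∀ {n k} → (Fin n → Fin k) → Fin (suc n) → Fin (suc (suc k))
bindUnder e zero = zero
bindUnder e (suc i) = suc (suc (e i))

flat⁺ flat⁻ : ∀ {n} {φ : Formula n} → Δ₀ φ → ∀ {k} → (Fin n → Fin k) → Fin k → Flat k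
flat⁺ δ⊥ e bi = ffF
flat⁺ (δ≐ s t) e bi = evalPairInto s t e bi (pos (eqV f1 f0))
flat⁺ (δ≼ s t) e bi = evalPairInto s t e bi (pos (leV f1 f0))
flat⁺ (δ⇒ d1 d2) e bi = flat⁻ d1 e bi ∨F flat⁺ d2 e bi
flat⁺ (δ∧ d1 d2) e bi = flat⁺ d1 e bi ∧F flat⁺ d2 e bi
flat⁺ (δ∨ d1 d2) e bi = flat⁺ d1 e bi ∨F flat⁺ d2 e bi
flat⁺ (δ∀≤ t d) e bi = ∃F bi (evalInto t (fsuc ∘ e) (suc bi) zero ∧F ∀F zero (flat⁺ d (bindUnder e) (suc (suc bi))))
flat⁺ (δ∃≤ t d) e bi = ∃F bi (evalInto t (fsuc ∘ e) (suc bi) zero ∧F ∃F zero (flat⁺ d (bindUnder e) (suc (suc bi))))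
flat⁻ δ⊥ e bi = ttF
flat⁻ (δ≐ s t) e bi = evalPairInto s t e bi (neg (eqV f1 f0))
flat⁻ (δ≼ s t) e bi = evalPairInto s t e bi (neg (leV f1 f0))
flat⁻ (δ⇒ d1 d2) e bi = flat⁺ d1 e bi ∧F flat⁻ d2 e bi
flat⁻ (δ∧ d1 d2) e bi = flat⁻ d1 e bi ∨F flat⁻ d2 e bi
flat⁻ (δ∨ d1 d2) e bi = flat⁻ d1 e bi ∧F flat⁻ d2 e bi
flat⁻ (δ∀≤ t d) e bi = ∃F bi (evalInto t (fsuc ∘ e) (suc bi) zero ∧F ∃F zero (flat⁻ d (bindUnder e) (suc (suc bi))))
flat⁻ (δ∃≤ t d) e bi = ∃F bi (evalInto t (fsuc ∘ e) (suc bi) zero ∧F ∀F zero (flat⁻ d (bindUnder e) (suc (suc bi))))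

flatΣ : ∀ {n} {φ : Formula n} → Σ₁ φ → ∀ {k} → (Fin n → Fin k) → Fin k → Flat k
flatΣ (σΔ₀ d) e bi = flat⁺ d e bi
flatΣ (σ∃ h) e bi = ∃F bi (flatΣ h (liftR e) (suc bi))

evalT-cong : ∀ {n} {ρ ρ' : Fin n → ℕ} → ρ ≗ ρ' → ∀ t → evalT ρ t ≡ evalT ρ' t
evalT-cong E (var i) = E i
evalT-cong E `0 = refl
evalT-cong E (`S t) = cong suc (evalT-cong E t)
evalT-cong E (s ⊕ t) = cong₂ N._+_ (evalT-cong E s) (evalT-cong E t)
evalT-cong E (s ⊗ t) = cong₂ N._*_ (evalT-cong E s) (evalT-cong E t)

evalT-renT : ∀ {n m} (ρ : Fin m → ℕ) (r : Fin n → Fin m) t → evalT ρ (renT r t) ≡ evalT (ρ ∘ r) t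
evalT-renT ρ r (var i) = refl
evalT-renT ρ r `0 = refl
evalT-renT ρ r (`S t) = cong suc (evalT-renT ρ r t)
evalT-renT ρ r (s ⊕ t) = cong₂ N._+_ (evalT-renT ρ r s) (evalT-renT ρ r t)
evalT-renT ρ r (s ⊗ t) = cong₂ N._*_ (evalT-renT ρ r s) (evalT-renT ρ r t)

extend-cong : ∀ {n} {ρ ρ' : Fin n → ℕ} → ρ ≗ ρ' → ∀ a → extend ρ a ≗ extend ρ' a
extend-cong E a zero = refl
extend-cong E a (suc i) = E i

Sat-cong : ∀ {n} {ρ ρ' : Fin n → ℕ} → ρ ≗ ρ' → ∀ φ → Sat ρ φ → Sat ρ' φ
Sat-cong E ⊥' x = x
Sat-cong E (s ≐ t) x = trans (sym (evalT-cong E s)) (trans x (evalT-cong E t))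
Sat-cong E (s ≼ t) x = subst₂ N._≤_ (evalT-cong E s) (evalT-cong E t) x
Sat-cong E (φ ⇒ ψ) f = λ y → Sat-cong E ψ (f (Sat-cong (λ i → sym (E i)) φ y))
Sat-cong E (φ ∧ ψ) (x , y) = Sat-cong E φ x , Sat-cong E ψ y
Sat-cong E (φ ∨ ψ) (inj₁ x) = inj₁ (Sat-cong E φ x)
Sat-cong E (φ ∨ ψ) (inj₂ y) = inj₂ (Sat-cong E ψ y)
Sat-cong E (∀' φ) f = λ a → Sat-cong (extend-cong E a) φ (f a)
Sat-cong E (∃' φ) (a , x) = a , Sat-cong (extend-cong E a) φ x

evalT-wkT : ∀ {n} (ρ : Fin n → ℕ) a t → evalT (extend ρ a) (wkT t) ≡ evalT ρ t
evalT-wkT ρ a t = evalT-renT (extend ρ a) suc t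

evalInto-sound : ∀ {n k} (t : Term n) (e : Fin n → Fin k) bi w (ρ' : Fin k → ℕ) → SatFlat ρ' (evalInto t e bi w) → ρ' w ≡ evalT (ρ' ∘ e) t
evalInto-sound (var i) e bi w ρ' h = h
evalInto-sound `0 e bi w ρ' h = h
evalInto-sound (`S t) e bi w ρ' (a , _ , h1 , h2) = trans h2 (cong suc (evalInto-sound t (fsuc ∘ e) (suc bi) zero (extend ρ' a) h1))
evalInto-sound (s ⊕ t) e bi w ρ' (a , _ , c , _ , (h1 , h2) , h3) =
  trans h3 (cong₂ N._+_ (evalInto-sound s (fsuc² ∘ e) (suc (suc bi)) f1 (extend (extend ρ' a) c) h1) (evalInto-sound t (fsuc² ∘ e) (suc (suc bi)) f0 (extend (extend ρ' a) c) h2))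
evalInto-sound (s ⊗ t) e bi w ρ' (a , _ , c , _ , (h1 , h2) , h3) =
  trans h3 (cong₂ N._*_ (evalInto-sound s (fsuc² ∘ e) (suc (suc bi)) f1 (extend (extend ρ' a) c) h1) (evalInto-sound t (fsuc² ∘ e) (suc (suc bi)) f0 (extend (extend ρ' a) c) h2))

evalBound : ∀ {n} → (Fin n → ℕ) → Term n → ℕ
pairBound : ∀ {n} → (Fin n → ℕ) → Term n → Term n → ℕ
evalBound ρ (var i) = 0
evalBound ρ `0 = 0
evalBound ρ (`S t) = evalBound ρ t N.+ evalT ρ t
evalBound ρ (s ⊕ t) = pairBound ρ s t
evalBound ρ (s ⊗ t) = pairBound ρ s t
pairBound ρ s t = (evalBound ρ s N.+ evalBound ρ t) N.+ (evalT ρ s N.+ evalT ρ t)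

evalInto-complete : ∀ {n k} (t : Term n) (ρ : Fin n → ℕ) (e : Fin n → Fin k) bi w (ρ' : Fin k → ℕ) → (λ i → ρ' (e i)) ≗ ρ →
      evalBound ρ t N.≤ ρ' bi → ρ' w ≡ evalT ρ t → SatFlat ρ' (evalInto t e bi w)
evalPairInto-complete : ∀ {n k} (s t : Term n) (ρ : Fin n → ℕ) (e : Fin n → Fin k) bi (A : Flat (suc (suc k))) (ρ' : Fin k → ℕ) →
      (λ i → ρ' (e i)) ≗ ρ → pairBound ρ s t N.≤ ρ' bi →
      SatFlat (extend (extend ρ' (evalT ρ s)) (evalT ρ t)) A → SatFlat ρ' (evalPairInto s t e bi A)
evalInto-complete (var i) ρ e bi w ρ' E q h = trans h (sym (E i))
evalInto-complete `0 ρ e bi w ρ' E q h = h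
evalInto-complete (`S t) ρ e bi w ρ' E q h =
  evalT ρ t , NP.m+n≤o⇒n≤o (evalBound ρ t) q ,
  evalInto-complete t ρ (fsuc ∘ e) (suc bi) zero (extend ρ' (evalT ρ t)) E (NP.m+n≤o⇒m≤o (evalBound ρ t) q) refl , h
evalInto-complete (s ⊕ t) ρ e bi w ρ' E q h = evalPairInto-complete s t ρ e bi (pos (eqP (suc (suc w)) f1 f0)) ρ' E q h
evalInto-complete (s ⊗ t) ρ e bi w ρ' E q h = evalPairInto-complete s t ρ e bi (pos (eqT (suc (suc w)) f1 f0)) ρ' E q h
evalPairInto-complete s t ρ e bi A ρ' E q h =
  es , NP.m+n≤o⇒m≤o (es) (NP.m+n≤o⇒n≤o (ns N.+ nt) q) , et , NP.m+n≤o⇒n≤o (es) (NP.m+n≤o⇒n≤o (ns N.+ nt) q) ,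
  (evalInto-complete s ρ (fsuc² ∘ e) (suc (suc bi)) f1 ρ'' E (NP.m+n≤o⇒m≤o (ns) (NP.m+n≤o⇒m≤o (ns N.+ nt) q)) refl ,
   evalInto-complete t ρ (fsuc² ∘ e) (suc (suc bi)) f0 ρ'' E (NP.m+n≤o⇒n≤o (ns) (NP.m+n≤o⇒m≤o (ns N.+ nt) q)) refl) , h
  where
    es = evalT ρ s
    et = evalT ρ t
    ns = evalBound ρ s
    nt = evalBound ρ t
    ρ'' = extend (extend ρ' es) et

bound-from-wkT : ∀ {n} (ρ : Fin n → ℕ) a t v → v ≡ evalT ρ t → a N.≤ evalT (extend ρ a) (wkT t) → a N.≤ v
bound-from-wkT ρ a t v e q = subst (a N.≤_) (trans (evalT-wkT ρ a t) (sym e)) q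

bound-to-wkT : ∀ {n} (ρ : Fin n → ℕ) a t v → v ≡ evalT ρ t → a N.≤ v → a N.≤ evalT (extend ρ a) (wkT t)
bound-to-wkT ρ a t v e q = subst (a N.≤_) (trans e (sym (evalT-wkT ρ a t))) q

extend-bindUnder : ∀ {n k} (e : Fin n → Fin k) (ρ' : Fin k → ℕ) v a → (λ i → extend (extend ρ' v) a (bindUnder e i)) ≗ extend (λ i → ρ' (e i)) a
extend-bindUnder e ρ' v a zero = refl
extend-bindUnder e ρ' v a (suc i) = refl

≗-sym : ∀ {n} {ρ ρ' : Fin n → ℕ} → ρ ≗ ρ' → ρ' ≗ ρ
≗-sym E i = sym (E i)

flat⁺-sound : ∀ {n} {φ : Formula n} (d : Δ₀ φ) {k} (e : Fin n → Fin k) bi (ρ' : Fin k → ℕ) → SatFlat ρ' (flat⁺ d e bi) → Sat (λ i → ρ' (e i)) φ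
flat⁻-sound : ∀ {n} {φ : Formula n} (d : Δ₀ φ) {k} (e : Fin n → Fin k) bi (ρ' : Fin k → ℕ) → SatFlat ρ' (flat⁻ d e bi) → ¬ Sat (λ i → ρ' (e i)) φ
flat⁺-sound δ⊥ e bi ρ' ()
flat⁺-sound (δ≐ s t) e bi ρ' (a , _ , c , _ , (h1 , h2) , h3) =
  trans (sym (evalInto-sound s (fsuc² ∘ e) (suc (suc bi)) f1 (extend (extend ρ' a) c) h1))
        (trans h3 (evalInto-sound t (fsuc² ∘ e) (suc (suc bi)) f0 (extend (extend ρ' a) c) h2))
flat⁺-sound (δ≼ s t) e bi ρ' (a , _ , c , _ , (h1 , h2) , h3) =
  subst₂ N._≤_ (evalInto-sound s (fsuc² ∘ e) (suc (suc bi)) f1 (extend (extend ρ' a) c) h1)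
               (evalInto-sound t (fsuc² ∘ e) (suc (suc bi)) f0 (extend (extend ρ' a) c) h2) h3
flat⁺-sound (δ⇒ d1 d2) e bi ρ' (inj₁ x) = λ y → ⊥-elim (flat⁻-sound d1 e bi ρ' x y)
flat⁺-sound (δ⇒ d1 d2) e bi ρ' (inj₂ y) = λ _ → flat⁺-sound d2 e bi ρ' y
flat⁺-sound (δ∧ d1 d2) e bi ρ' (x , y) = flat⁺-sound d1 e bi ρ' x , flat⁺-sound d2 e bi ρ' y
flat⁺-sound (δ∨ d1 d2) e bi ρ' (inj₁ x) = inj₁ (flat⁺-sound d1 e bi ρ' x)
flat⁺-sound (δ∨ d1 d2) e bi ρ' (inj₂ y) = inj₂ (flat⁺-sound d2 e bi ρ' y)
flat⁺-sound (δ∀≤ t {φ} d) e bi ρ' (v , _ , hEv , hAll) = λ a q →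
  Sat-cong (extend-bindUnder e ρ' v a) φ (flat⁺-sound d (bindUnder e) (suc (suc bi)) (extend (extend ρ' v) a)
    (hAll a (bound-from-wkT (λ i → ρ' (e i)) a t v (evalInto-sound t (fsuc ∘ e) (suc bi) zero (extend ρ' v) hEv) q)))
flat⁺-sound (δ∃≤ t {φ} d) e bi ρ' (v , _ , hEv , (a , q , h)) =
  a , bound-to-wkT (λ i → ρ' (e i)) a t v (evalInto-sound t (fsuc ∘ e) (suc bi) zero (extend ρ' v) hEv) q ,
  Sat-cong (extend-bindUnder e ρ' v a) φ (flat⁺-sound d (bindUnder e) (suc (suc bi)) (extend (extend ρ' v) a) h)
flat⁻-sound δ⊥ e bi ρ' _ x = x
flat⁻-sound (δ≐ s t) e bi ρ' (a , _ , c , _ , (h1 , h2) , h3) x =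
  h3 (trans (evalInto-sound s (fsuc² ∘ e) (suc (suc bi)) f1 (extend (extend ρ' a) c) h1)
        (trans x (sym (evalInto-sound t (fsuc² ∘ e) (suc (suc bi)) f0 (extend (extend ρ' a) c) h2))))
flat⁻-sound (δ≼ s t) e bi ρ' (a , _ , c , _ , (h1 , h2) , h3) x =
  h3 (subst₂ N._≤_ (sym (evalInto-sound s (fsuc² ∘ e) (suc (suc bi)) f1 (extend (extend ρ' a) c) h1))
                   (sym (evalInto-sound t (fsuc² ∘ e) (suc (suc bi)) f0 (extend (extend ρ' a) c) h2)) x)
flat⁻-sound (δ⇒ d1 d2) e bi ρ' (x , y) f = flat⁻-sound d2 e bi ρ' y (f (flat⁺-sound d1 e bi ρ' x))
flat⁻-sound (δ∧ d1 d2) e bi ρ' (inj₁ x) p = flat⁻-sound d1 e bi ρ' x (proj₁ p)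
flat⁻-sound (δ∧ d1 d2) e bi ρ' (inj₂ y) p = flat⁻-sound d2 e bi ρ' y (proj₂ p)
flat⁻-sound (δ∨ d1 d2) e bi ρ' (x , y) (inj₁ p) = flat⁻-sound d1 e bi ρ' x p
flat⁻-sound (δ∨ d1 d2) e bi ρ' (x , y) (inj₂ p) = flat⁻-sound d2 e bi ρ' y p
flat⁻-sound (δ∀≤ t {φ} d) e bi ρ' (v , _ , hEv , (a , q , h)) f =
  flat⁻-sound d (bindUnder e) (suc (suc bi)) (extend (extend ρ' v) a) h
    (Sat-cong (≗-sym (extend-bindUnder e ρ' v a)) φ (f a (bound-to-wkT (λ i → ρ' (e i)) a t v (evalInto-sound t (fsuc ∘ e) (suc bi) zero (extend ρ' v) hEv) q)))
flat⁻-sound (δ∃≤ t {φ} d) e bi ρ' (v , _ , hEv , hAll) (a , q , x) =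
  flat⁻-sound d (bindUnder e) (suc (suc bi)) (extend (extend ρ' v) a)
    (hAll a (bound-from-wkT (λ i → ρ' (e i)) a t v (evalInto-sound t (fsuc ∘ e) (suc bi) zero (extend ρ' v) hEv) q))
    (Sat-cong (≗-sym (extend-bindUnder e ρ' v a)) φ x)

flatΣ-sound : ∀ {n} {φ : Formula n} (h : Σ₁ φ) {k} (e : Fin n → Fin k) bi (ρ' : Fin k → ℕ) → SatFlat ρ' (flatΣ h e bi) → Sat (λ i → ρ' (e i)) φ
flatΣ-sound (σΔ₀ d) e bi ρ' x = flat⁺-sound d e bi ρ' x
flatΣ-sound (σ∃ {φ} h) e bi ρ' (a , _ , x) = a , Sat-cong E φ (flatΣ-sound h (liftR e) (suc bi) (extend ρ' a) x)
  where
    E : (λ i → extend ρ' a (liftR e i)) ≗ extend (λ i → ρ' (e i)) a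
    E zero = refl
    E (suc i) = refl

HoldsAbove : ∀ {n} → (Fin n → ℕ) → (∀ {k} → (Fin n → Fin k) → Fin k → Flat k) → Set
HoldsAbove {n} ρ F = Σ ℕ λ N → ∀ {k} (e : Fin n → Fin k) bi (ρ' : Fin k → ℕ) → (λ i → ρ' (e i)) ≗ ρ → N N.≤ ρ' bi → SatFlat ρ' (F e bi)

bounded-max : ∀ (a : ℕ) (f : ∀ c → c N.≤ a → ℕ) → Σ ℕ (λ M → ∀ c p → f c p N.≤ M)
bounded-max zero f = f zero z≤n , λ { zero z≤n → NP.≤-refl }
bounded-max (suc a) f with bounded-max a (λ c p → f c (NP.m≤n⇒m≤1+n p))
... | M' , H = M' N.+ f (suc a) NP.≤-refl , h
  where
    h : ∀ c p → f c p N.≤ M' N.+ f (suc a) NP.≤-refl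
    h c p with NP.m≤n⇒m<n∨m≡n p
    ... | inj₁ q = NP.≤-trans (NP.≤-reflexive (cong (f c) (NP.≤-irrelevant p (NP.m≤n⇒m≤1+n (NP.≤-pred q)))))
                     (NP.≤-trans (H c (NP.≤-pred q)) (NP.m≤m+n M' _))
    ... | inj₂ refl = NP.≤-trans (NP.≤-reflexive (cong (f (suc a)) (NP.≤-irrelevant p NP.≤-refl))) (NP.m≤n+m _ M')

evalPairInto-holdsAbove : ∀ {n} (s t : Term n) (ρ : Fin n → ℕ) (A : ∀ {k} → Flat (suc (suc k))) →
           (∀ {k} (ρ2 : Fin (suc (suc k)) → ℕ) → ρ2 f1 ≡ evalT ρ s → ρ2 f0 ≡ evalT ρ t → SatFlat ρ2 A) →
           HoldsAbove ρ (λ e bi → evalPairInto s t e bi A)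
evalPairInto-holdsAbove s t ρ A H =
  pairBound ρ s t , λ e bi ρ' E q → evalPairInto-complete s t ρ e bi A ρ' E q (H _ refl refl)

holdsAbove-∨₁ : ∀ {n} {ρ : Fin n → ℕ} {F G : ∀ {k} → (Fin n → Fin k) → Fin k → Flat k} → HoldsAbove ρ F → HoldsAbove ρ (λ e bi → F e bi ∨F G e bi)
holdsAbove-∨₁ (N , g) = N , λ e bi ρ' E q → inj₁ (g e bi ρ' E q)
holdsAbove-∨₂ : ∀ {n} {ρ : Fin n → ℕ} {F G : ∀ {k} → (Fin n → Fin k) → Fin k → Flat k} → HoldsAbove ρ G → HoldsAbove ρ (λ e bi → F e bi ∨F G e bi)
holdsAbove-∨₂ (N , g) = N , λ e bi ρ' E q → inj₂ (g e bi ρ' E q)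
holdsAbove-∧ : ∀ {n} {ρ : Fin n → ℕ} {F G : ∀ {k} → (Fin n → Fin k) → Fin k → Flat k} → HoldsAbove ρ F → HoldsAbove ρ G → HoldsAbove ρ (λ e bi → F e bi ∧F G e bi)
holdsAbove-∧ (N , g) (M , h) = N N.+ M , λ e bi ρ' E q → g e bi ρ' E (NP.m+n≤o⇒m≤o _ q) , h e bi ρ' E (NP.m+n≤o⇒n≤o N q)

extend-bindUnder-≗ : ∀ {n k} (e : Fin n → Fin k) (ρ' : Fin k → ℕ) (ρ : Fin n → ℕ) → (λ i → ρ' (e i)) ≗ ρ → ∀ v a →
        (λ i → extend (extend ρ' v) a (bindUnder e i)) ≗ extend ρ a
extend-bindUnder-≗ e ρ' ρ E v a zero = refl
extend-bindUnder-≗ e ρ' ρ E v a (suc i) = E i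

holdsAbove-∀≤ : ∀ {n} (t : Term n) (ρ : Fin n → ℕ) (G : ∀ {k} → (Fin (suc n) → Fin k) → Fin k → Flat k) →
  (∀ c → c N.≤ evalT ρ t → HoldsAbove (extend ρ c) G) →
  HoldsAbove ρ (λ e bi → ∃F bi (evalInto t (fsuc ∘ e) (suc bi) zero ∧F ∀F zero (G (bindUnder e) (suc (suc bi)))))
holdsAbove-∀≤ t ρ G H = (evalBound ρ t N.+ a) N.+ M , λ e bi ρ' E q →
  a , NP.m+n≤o⇒n≤o (evalBound ρ t) (NP.m+n≤o⇒m≤o _ q) , evalInto-complete t ρ (fsuc ∘ e) (suc bi) zero (extend ρ' a) E (NP.m+n≤o⇒m≤o _ (NP.m+n≤o⇒m≤o _ q)) refl ,
  λ y py → proj₂ (H y py) (bindUnder e) (suc (suc bi)) (extend (extend ρ' a) y) (extend-bindUnder-≗ e ρ' ρ E a y)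
             (NP.≤-trans (proj₂ BM y py) (NP.m+n≤o⇒n≤o (evalBound ρ t N.+ a) q))
  where
    a = evalT ρ t
    BM = bounded-max a (λ c p → proj₁ (H c p))
    M = proj₁ BM

holdsAbove-∃≤ : ∀ {n} (t : Term n) (ρ : Fin n → ℕ) (G : ∀ {k} → (Fin (suc n) → Fin k) → Fin k → Flat k) →
  ∀ c → c N.≤ evalT ρ t → HoldsAbove (extend ρ c) G →
  HoldsAbove ρ (λ e bi → ∃F bi (evalInto t (fsuc ∘ e) (suc bi) zero ∧F ∃F zero (G (bindUnder e) (suc (suc bi)))))
holdsAbove-∃≤ t ρ G c p (N , H) = (evalBound ρ t N.+ a) N.+ N , λ e bi ρ' E q →
  a , NP.m+n≤o⇒n≤o (evalBound ρ t) (NP.m+n≤o⇒m≤o _ q) , evalInto-complete t ρ (fsuc ∘ e) (suc bi) zero (extend ρ' a) E (NP.m+n≤o⇒m≤o _ (NP.m+n≤o⇒m≤o _ q)) refl ,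
  (c , p , H (bindUnder e) (suc (suc bi)) (extend (extend ρ' a) c) (extend-bindUnder-≗ e ρ' ρ E a c) (NP.m+n≤o⇒n≤o (evalBound ρ t N.+ a) q))
  where
    a = evalT ρ t

flat-complete : ∀ {n} {φ : Formula n} (d : Δ₀ φ) (ρ : Fin n → ℕ) → (Sat ρ φ × HoldsAbove ρ (flat⁺ d)) ⊎ ((¬ Sat ρ φ) × HoldsAbove ρ (flat⁻ d))
flat-complete δ⊥ ρ = inj₂ ((λ x → x) , 0 , λ e bi ρ' E q → tt)
flat-complete (δ≐ s t) ρ with evalT ρ s N.≟ evalT ρ t
... | yes p = inj₁ (p , evalPairInto-holdsAbove s t ρ (pos (eqV f1 f0)) λ ρ2 h1 h2 → trans h1 (trans p (sym h2)))
... | no np = inj₂ (np , evalPairInto-holdsAbove s t ρ (neg (eqV f1 f0)) λ ρ2 h1 h2 x → np (trans (sym h1) (trans x h2)))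
flat-complete (δ≼ s t) ρ with evalT ρ s N.≤? evalT ρ t
... | yes p = inj₁ (p , evalPairInto-holdsAbove s t ρ (pos (leV f1 f0)) λ ρ2 h1 h2 → subst₂ N._≤_ (sym h1) (sym h2) p)
... | no np = inj₂ (np , evalPairInto-holdsAbove s t ρ (neg (leV f1 f0)) λ ρ2 h1 h2 x → np (subst₂ N._≤_ h1 h2 x))
flat-complete (δ⇒ d1 d2) ρ with flat-complete d1 ρ | flat-complete d2 ρ
... | inj₂ (np , G) | _ = inj₁ ((λ x → ⊥-elim (np x)) , holdsAbove-∨₁ {F = flat⁻ d1} {G = flat⁺ d2} G)
... | inj₁ _ | inj₁ (q , G) = inj₁ ((λ _ → q) , holdsAbove-∨₂ {F = flat⁻ d1} {G = flat⁺ d2} G)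
... | inj₁ (p , G1) | inj₂ (nq , G2) = inj₂ ((λ f → nq (f p)) , holdsAbove-∧ {F = flat⁺ d1} {G = flat⁻ d2} G1 G2)
flat-complete (δ∧ d1 d2) ρ with flat-complete d1 ρ | flat-complete d2 ρ
... | inj₁ (p , G1) | inj₁ (q , G2) = inj₁ ((p , q) , holdsAbove-∧ {F = flat⁺ d1} {G = flat⁺ d2} G1 G2)
... | inj₂ (np , G) | _ = inj₂ ((λ x → np (proj₁ x)) , holdsAbove-∨₁ {F = flat⁻ d1} {G = flat⁻ d2} G)
... | inj₁ _ | inj₂ (nq , G) = inj₂ ((λ x → nq (proj₂ x)) , holdsAbove-∨₂ {F = flat⁻ d1} {G = flat⁻ d2} G)
flat-complete (δ∨ d1 d2) ρ with flat-complete d1 ρ | flat-complete d2 ρ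
... | inj₁ (p , G) | _ = inj₁ (inj₁ p , holdsAbove-∨₁ {F = flat⁺ d1} {G = flat⁺ d2} G)
... | inj₂ _ | inj₁ (q , G) = inj₁ (inj₂ q , holdsAbove-∨₂ {F = flat⁺ d1} {G = flat⁺ d2} G)
... | inj₂ (np , G1) | inj₂ (nq , G2) = inj₂ ((λ { (inj₁ x) → np x ; (inj₂ y) → nq y }) , holdsAbove-∧ {F = flat⁻ d1} {G = flat⁻ d2} G1 G2)
flat-complete (δ∀≤ t d) ρ with bounded-search (evalT ρ t) (λ c p → flat-complete d (extend ρ c))
... | inj₁ g = inj₁ ((λ c q → proj₁ (g c (bound-from-wkT ρ c t _ refl q))) , holdsAbove-∀≤ t ρ (flat⁺ d) (λ c p → proj₂ (g c p)))
... | inj₂ (c , p , (np , G)) = inj₂ ((λ f → np (f c (bound-to-wkT ρ c t _ refl p))) , holdsAbove-∃≤ t ρ (flat⁻ d) c p G)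
flat-complete (δ∃≤ t d) ρ with bounded-search (evalT ρ t) (λ c p → Data.Sum.swap (flat-complete d (extend ρ c)))
... | inj₁ g = inj₂ ((λ { (c , q , x) → proj₁ (g c (bound-from-wkT ρ c t _ refl q)) x }) , holdsAbove-∀≤ t ρ (flat⁻ d) (λ c p → proj₂ (g c p)))
... | inj₂ (c , p , (x , G)) = inj₁ ((c , bound-to-wkT ρ c t _ refl p , x) , holdsAbove-∃≤ t ρ (flat⁺ d) c p G)

flatΣ-complete : ∀ {n} {φ : Formula n} (h : Σ₁ φ) (ρ : Fin n → ℕ) → Sat ρ φ → HoldsAbove ρ (flatΣ h)
flatΣ-complete (σΔ₀ d) ρ x with flat-complete d ρ
... | inj₁ (_ , G) = G
... | inj₂ (np , _) = ⊥-elim (np x)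
flatΣ-complete (σ∃ h) ρ (a , x) with flatΣ-complete h (extend ρ a) x
... | N , G = a N.+ N , λ e bi ρ' E q → a , NP.m+n≤o⇒m≤o _ q , G (liftR e) (suc bi) (extend ρ' a) (extend-liftR-≗ e ρ' E) (NP.m+n≤o⇒n≤o a q)
  where
    extend-liftR-≗ : ∀ {k} (e : _ → Fin k) (ρ' : Fin k → ℕ) → (λ i → ρ' (e i)) ≗ ρ → (λ i → extend ρ' a (liftR e i)) ≗ extend ρ a
    extend-liftR-≗ e ρ' E zero = refl
    extend-liftR-≗ e ρ' E (suc i) = E i

module _ {T : Theory} where
  ≼-substˡ : ∀ {n} {Γ : List (Formula n)} {u u' B} → T ⨾ Γ ⊢ u ≐ u' → T ⨾ Γ ⊢ u ≼ B → T ⨾ Γ ⊢ u' ≼ B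
  ≼-substˡ {u = u} {u'} {B} e d = ≐-rewrite (var zero ≼ wkT B) e (cong (u ≼_) (subT-single-wkT u B)) (cong (u' ≼_) (subT-single-wkT u' B)) d
  ≼-substʳ : ∀ {n} {Γ : List (Formula n)} {u u' A} → T ⨾ Γ ⊢ u ≐ u' → T ⨾ Γ ⊢ A ≼ u → T ⨾ Γ ⊢ A ≼ u'
  ≼-substʳ {u = u} {u'} {A} e d = ≐-rewrite (wkT A ≼ var zero) e (cong (_≼ u) (subT-single-wkT u A)) (cong (_≼ u') (subT-single-wkT u' A)) d
  `S-subst : ∀ {n} {Γ : List (Formula n)} {u u' A} → T ⨾ Γ ⊢ u ≐ u' → T ⨾ Γ ⊢ A ≐ `S u → T ⨾ Γ ⊢ A ≐ `S u'
  `S-subst {u = u} {u'} {A} e d = ≐-rewrite (wkT A ≐ `S (var zero)) e (cong (_≐ `S u) (subT-single-wkT u A)) (cong (_≐ `S u') (subT-single-wkT u' A)) d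
  ⊕-substˡ : ∀ {n} {Γ : List (Formula n)} {u u' A B} → T ⨾ Γ ⊢ u ≐ u' → T ⨾ Γ ⊢ A ≐ u ⊕ B → T ⨾ Γ ⊢ A ≐ u' ⊕ B
  ⊕-substˡ {u = u} {u'} {A} {B} e d = ≐-rewrite (wkT A ≐ var zero ⊕ wkT B) e
    (cong₂ (λ x y → x ≐ u ⊕ y) (subT-single-wkT u A) (subT-single-wkT u B)) (cong₂ (λ x y → x ≐ u' ⊕ y) (subT-single-wkT u' A) (subT-single-wkT u' B)) d
  ⊕-substʳ : ∀ {n} {Γ : List (Formula n)} {u u' A B} → T ⨾ Γ ⊢ u ≐ u' → T ⨾ Γ ⊢ A ≐ B ⊕ u → T ⨾ Γ ⊢ A ≐ B ⊕ u'
  ⊕-substʳ {u = u} {u'} {A} {B} e d = ≐-rewrite (wkT A ≐ wkT B ⊕ var zero) e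
    (cong₂ (λ x y → x ≐ y ⊕ u) (subT-single-wkT u A) (subT-single-wkT u B)) (cong₂ (λ x y → x ≐ y ⊕ u') (subT-single-wkT u' A) (subT-single-wkT u' B)) d
  ⊗-substˡ : ∀ {n} {Γ : List (Formula n)} {u u' A B} → T ⨾ Γ ⊢ u ≐ u' → T ⨾ Γ ⊢ A ≐ u ⊗ B → T ⨾ Γ ⊢ A ≐ u' ⊗ B
  ⊗-substˡ {u = u} {u'} {A} {B} e d = ≐-rewrite (wkT A ≐ var zero ⊗ wkT B) e
    (cong₂ (λ x y → x ≐ u ⊗ y) (subT-single-wkT u A) (subT-single-wkT u B)) (cong₂ (λ x y → x ≐ u' ⊗ y) (subT-single-wkT u' A) (subT-single-wkT u' B)) d
  ⊗-substʳ : ∀ {n} {Γ : List (Formula n)} {u u' A B} → T ⨾ Γ ⊢ u ≐ u' → T ⨾ Γ ⊢ A ≐ B ⊗ u → T ⨾ Γ ⊢ A ≐ B ⊗ u'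
  ⊗-substʳ {u = u} {u'} {A} {B} e d = ≐-rewrite (wkT A ≐ wkT B ⊗ var zero) e
    (cong₂ (λ x y → x ≐ y ⊗ u) (subT-single-wkT u A) (subT-single-wkT u B)) (cong₂ (λ x y → x ≐ y ⊗ u') (subT-single-wkT u' A) (subT-single-wkT u' B)) d

subT-wkT : ∀ {n m} (σ : Fin n → Term m) t → subT (wkT ∘ σ) t ≡ wkT (subT σ t)
subT-wkT σ t = sym (renT-subT suc σ t)

subT-wkT² : ∀ {n m} (σ : Fin n → Term m) t → subT (λ i → wkT (wkT (σ i))) t ≡ wkT (wkT (subT σ t))
subT-wkT² σ t = trans (subT-wkT (wkT ∘ σ) t) (cong wkT (subT-wkT σ t))

evalInto-derive : ∀ {T n k m} {Γ : List (Formula m)} (t : Term n) (e : Fin n → Fin k) bi w (τ : Fin k → Term m) →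
      T ⨾ Γ ⊢ toFormula (evalInto t e bi w) τ → T ⨾ Γ ⊢ τ w ≐ subT (τ ∘ e) t
evalPairInto-elim : ∀ {T n k m} {Γ : List (Formula m)} (s t : Term n) (e : Fin n → Fin k) bi (A : Flat (suc (suc k))) (τ : Fin k → Term m) {G} →
      T ⨾ Γ ⊢ toFormula (evalPairInto s t e bi A) τ →
      (∀ {Δ : List (Formula (suc (suc m)))} → T ⨾ Δ ⊢ var (suc zero) ≐ wkT (wkT (subT (τ ∘ e) s)) →
          T ⨾ Δ ⊢ var zero ≐ wkT (wkT (subT (τ ∘ e) t)) → T ⨾ Δ ⊢ toFormula A (liftS (liftS τ)) → T ⨾ Δ ⊢ wkF (wkF G)) →
      T ⨾ Γ ⊢ G
evalInto-derive (var i) e bi w τ d = d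
evalInto-derive `0 e bi w τ d = d
evalInto-derive (`S t) e bi w τ d = ∃E d
  (`S-subst (cast (cong (var zero ≐_) (subT-wkT (τ ∘ e) t)) (evalInto-derive t (fsuc ∘ e) (suc bi) zero (liftS τ) (∧E₁ (∧E₂ (hyp (here refl))))))
       (∧E₂ (∧E₂ (hyp (here refl)))))
evalInto-derive (s ⊕ t) e bi w τ d = evalPairInto-elim s t e bi (pos (eqP (suc (suc w)) f1 f0)) τ d λ hs ht ha → ⊕-substʳ ht (⊕-substˡ hs ha)
evalInto-derive (s ⊗ t) e bi w τ d = evalPairInto-elim s t e bi (pos (eqT (suc (suc w)) f1 f0)) τ d λ hs ht ha → ⊗-substʳ ht (⊗-substˡ hs ha)
evalPairInto-elim s t e bi A τ {G} d k = ∃E d (∃E (∧E₂ (hyp (here refl)))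
  (k (cast (cong (var (suc zero) ≐_) (subT-wkT² (τ ∘ e) s)) (evalInto-derive s (fsuc² ∘ e) (suc (suc bi)) f1 (liftS (liftS τ)) (∧E₁ (∧E₁ (∧E₂ (hyp (here refl)))))))
     (cast (cong (var zero ≐_) (subT-wkT² (τ ∘ e) t)) (evalInto-derive t (fsuc² ∘ e) (suc (suc bi)) f0 (liftS (liftS τ)) (∧E₂ (∧E₁ (∧E₂ (hyp (here refl)))))))
     (∧E₂ (∧E₂ (hyp (here refl))))))

∀-map : ∀ {T m} {Γ : List (Formula m)} {Z Z' : Formula (suc m)} → T ⨾ Γ ⊢ ∀' Z → T ⨾ Z ∷ map wkF Γ ⊢ Z' → T ⨾ Γ ⊢ ∀' Z'
∀-map {Z = Z} d D = ∀I (⇒E (⇒I D) (cast (shiftUnder-var Z) (∀E (⊢-rename suc (∈-map⁺ wkF) d) (var zero))))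

∃-map : ∀ {T m} {Γ : List (Formula m)} {Z Z' : Formula (suc m)} → T ⨾ Γ ⊢ ∃' Z → T ⨾ Z ∷ map wkF Γ ⊢ Z' → T ⨾ Γ ⊢ ∃' Z'
∃-map {Z' = Z'} d D = ∃E d (∃I (var zero) (cast (sym (shiftUnder-var Z')) D))

renT-liftR-wkT : ∀ {n m} (r : Fin n → Fin m) X → renT (liftR r) (wkT X) ≡ wkT (renT r X)
renT-liftR-wkT r X = trans (renT-∘ (liftR r) suc X) (sym (renT-∘ suc r X))

bound-shift : ∀ {n m} (σ : Fin n → Term m) t → renT (liftR suc) (subT (liftS σ) (wkT t)) ≡ wkT (wkT (subT σ t))
bound-shift σ t = trans (cong (renT (liftR suc)) (subT-liftS-wkT σ t)) (renT-liftR-wkT suc (subT σ t))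

bindUnder-subst : ∀ {n k m} (e : Fin n → Fin k) (τ : Fin k → Term m) (φ : Formula (suc n)) →
        subF (λ i → liftS (liftS τ) (bindUnder e i)) φ ≡ renF (liftR suc) (subF (liftS (λ i → τ (e i))) φ)
bindUnder-subst e τ φ = trans (subF-cong E φ) (sym (renF-subF (liftR suc) (liftS (λ i → τ (e i))) φ))
  where
    E : (λ i → liftS (liftS τ) (bindUnder e i)) ≗ (λ i → renT (liftR suc) (liftS (λ i → τ (e i)) i))
    E zero = refl
    E (suc i) = sym (renT-liftR-wkT suc (τ (e i)))

evalInto-derive-under : ∀ {T n k m} {Γ : List (Formula m)} (t : Term n) (e : Fin n → Fin k) bi (τ : Fin k → Term m) {H} →
       T ⨾ H ∷ map wkF Γ ⊢ toFormula (evalInto t (fsuc ∘ e) (suc bi) zero) (liftS τ) → T ⨾ H ∷ map wkF Γ ⊢ var zero ≐ wkT (subT (τ ∘ e) t)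
evalInto-derive-under t e bi τ d = cast (cong (var zero ≐_) (subT-wkT (τ ∘ e) t)) (evalInto-derive t (fsuc ∘ e) (suc bi) zero (liftS τ) d)

flat⁺-derive : ∀ {T n} {φ : Formula n} (d : Δ₀ φ) {k m} {Γ : List (Formula m)} (e : Fin n → Fin k) bi (τ : Fin k → Term m) →
       T ⨾ Γ ⊢ toFormula (flat⁺ d e bi) τ → T ⨾ Γ ⊢ subF (τ ∘ e) φ
flat⁻-derive : ∀ {T n} {φ : Formula n} (d : Δ₀ φ) {k m} {Γ : List (Formula m)} (e : Fin n → Fin k) bi (τ : Fin k → Term m) →
       T ⨾ Γ ⊢ toFormula (flat⁻ d e bi) τ → T ⨾ Γ ⊢ ¬' (subF (τ ∘ e) φ)
flat⁺-derive δ⊥ e bi τ D = D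
flat⁺-derive (δ≐ s t) e bi τ D = evalPairInto-elim s t e bi (pos (eqV f1 f0)) τ D (λ hs ht ha → ≐trans (≐sym hs) (≐trans ha ht))
flat⁺-derive (δ≼ s t) e bi τ D = evalPairInto-elim s t e bi (pos (leV f1 f0)) τ D (λ hs ht ha → ≼-substʳ ht (≼-substˡ hs ha))
flat⁺-derive (δ⇒ d1 d2) e bi τ D = ∨E D (⇒I (⊢-explode (⇒E (⊢-weaken there (flat⁻-derive d1 e bi τ (hyp (here refl)))) (hyp (here refl)))))
                                  (⇒I (⊢-weaken there (flat⁺-derive d2 e bi τ (hyp (here refl)))))
flat⁺-derive (δ∧ d1 d2) e bi τ D = ∧I (flat⁺-derive d1 e bi τ (∧E₁ D)) (flat⁺-derive d2 e bi τ (∧E₂ D))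
flat⁺-derive (δ∨ d1 d2) e bi τ D = ∨E D (∨I₁ (flat⁺-derive d1 e bi τ (hyp (here refl)))) (∨I₂ (flat⁺-derive d2 e bi τ (hyp (here refl))))
flat⁺-derive (δ∀≤ t {φ} d) e bi τ D = ∃E D
  (cast (cong (λ x → ∀' ((var zero ≼ x) ⇒ renF (liftR suc) (subF (liftS (τ ∘ e)) φ))) (sym (bound-shift (τ ∘ e) t)))
    (∀-map (∧E₂ (∧E₂ (hyp (here refl))))
      (⇒I (cast (bindUnder-subst e τ φ) (flat⁺-derive d (bindUnder e) (suc (suc bi)) (liftS (liftS τ))
        (⇒E (hyp (there (here refl)))
            (≼-substʳ (≐sym (⊢-rename suc (λ x → there (there (∈-map⁺ wkF x))) (evalInto-derive-under t e bi τ (∧E₁ (∧E₂ (hyp (here refl)))))))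
                   (hyp (here refl)))))))))
flat⁺-derive (δ∃≤ t {φ} d) e bi τ D = ∃E D
  (cast (cong (λ x → ∃' ((var zero ≼ x) ∧ renF (liftR suc) (subF (liftS (τ ∘ e)) φ))) (sym (bound-shift (τ ∘ e) t)))
    (∃-map (∧E₂ (∧E₂ (hyp (here refl))))
      (∧I (≼-substʳ (⊢-rename suc (λ x → there (∈-map⁺ wkF x)) (evalInto-derive-under t e bi τ (∧E₁ (∧E₂ (hyp (here refl)))))) (∧E₁ (hyp (here refl))))
          (cast (bindUnder-subst e τ φ) (flat⁺-derive d (bindUnder e) (suc (suc bi)) (liftS (liftS τ)) (∧E₂ (hyp (here refl))))))))
flat⁻-derive δ⊥ e bi τ D = D
flat⁻-derive (δ≐ s t) e bi τ D = evalPairInto-elim s t e bi (neg (eqV f1 f0)) τ D (λ hs ht ha →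
  ⇒I (⇒E (⊢-weaken there ha) (≐trans (⊢-weaken there hs) (≐trans (hyp (here refl)) (≐sym (⊢-weaken there ht))))))
flat⁻-derive (δ≼ s t) e bi τ D = evalPairInto-elim s t e bi (neg (leV f1 f0)) τ D (λ hs ht ha →
  ⇒I (⇒E (⊢-weaken there ha) (≼-substˡ (≐sym (⊢-weaken there hs)) (≼-substʳ (≐sym (⊢-weaken there ht)) (hyp (here refl))))))
flat⁻-derive (δ⇒ d1 d2) e bi τ D = ⇒I (⇒E (⊢-weaken there (flat⁻-derive d2 e bi τ (∧E₂ D))) (⇒E (hyp (here refl)) (⊢-weaken there (flat⁺-derive d1 e bi τ (∧E₁ D)))))
flat⁻-derive (δ∧ d1 d2) e bi τ D = ⇒I (∨E (⊢-weaken there D) (⇒E (flat⁻-derive d1 e bi τ (hyp (here refl))) (∧E₁ (hyp (there (here refl)))))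
                                                 (⇒E (flat⁻-derive d2 e bi τ (hyp (here refl))) (∧E₂ (hyp (there (here refl))))))
flat⁻-derive (δ∨ d1 d2) e bi τ D = ⇒I (∨E (hyp (here refl)) (⇒E (flat⁻-derive d1 e bi τ (∧E₁ (⊢-weaken (λ x → there (there x)) D))) (hyp (here refl)))
                                                   (⇒E (flat⁻-derive d2 e bi τ (∧E₂ (⊢-weaken (λ x → there (there x)) D))) (hyp (here refl))))
flat⁻-derive (δ∀≤ t {φ} d) e bi τ D = ∃E D
  (cast (cong (λ x → ¬' (∀' ((var zero ≼ x) ⇒ renF (liftR suc) (subF (liftS (τ ∘ e)) φ)))) (sym (bound-shift (τ ∘ e) t)))
    (⇒I (∃E (∧E₂ (∧E₂ (hyp (there (here refl)))))
      (⇒E (cast (cong ¬' (bindUnder-subst e τ φ)) (flat⁻-derive d (bindUnder e) (suc (suc bi)) (liftS (liftS τ)) (∧E₂ (hyp (here refl)))))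
          (⇒E (cast (shiftUnder-var ((var zero ≼ wkT (wkT (subT (τ ∘ e) t))) ⇒ renF (liftR suc) (subF (liftS (τ ∘ e)) φ)))
                     (∀E (hyp (there (here refl))) (var zero)))
              (≼-substʳ (⊢-rename suc (λ x → there (there (∈-map⁺ wkF x))) (evalInto-derive-under t e bi τ (∧E₁ (∧E₂ (hyp (here refl))))))
                     (∧E₁ (hyp (here refl)))))))))
flat⁻-derive (δ∃≤ t {φ} d) e bi τ D = ∃E D
  (cast (cong (λ x → ¬' (∃' ((var zero ≼ x) ∧ renF (liftR suc) (subF (liftS (τ ∘ e)) φ)))) (sym (bound-shift (τ ∘ e) t)))
    (⇒I (∃E (hyp (here refl))
      (⇒E (cast (cong ¬' (bindUnder-subst e τ φ)) (flat⁻-derive d (bindUnder e) (suc (suc bi)) (liftS (liftS τ))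
             (⇒E (cast (shiftUnder-var ((var zero ≼ var (suc zero)) ⇒ toFormula (flat⁻ d (bindUnder e) (suc (suc bi))) (liftS (liftS τ))))
                        (∀E (⊢-rename suc (λ x → there (∈-map⁺ wkF (there x))) (∧E₂ (∧E₂ (hyp (here refl))))) (var zero)))
                 (≼-substʳ (≐sym (⊢-rename suc (λ x → there (there (∈-map⁺ wkF x))) (evalInto-derive-under t e bi τ (∧E₁ (∧E₂ (hyp (here refl)))))))
                        (∧E₁ (hyp (here refl)))))))
          (∧E₂ (hyp (here refl)))))))

flatΣ-derive : ∀ {T n} {φ : Formula n} (h : Σ₁ φ) {k m} {Γ : List (Formula m)} (e : Fin n → Fin k) bi (τ : Fin k → Term m) →
       T ⨾ Γ ⊢ toFormula (flatΣ h e bi) τ → T ⨾ Γ ⊢ subF (τ ∘ e) φ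
flatΣ-derive (σΔ₀ d) e bi τ D = flat⁺-derive d e bi τ D
flatΣ-derive (σ∃ {φ} h) e bi τ D = ∃-map D (cast (subF-cong (liftS∘liftR τ e) φ) (flatΣ-derive h (liftR e) (suc bi) (liftS τ) (∧E₂ (hyp (here refl)))))

flatSentence : ∀ {σ : Sentence} → Σ₁ σ → Flat 1
flatSentence h = flatΣ h fromFin0 zero

bracket : (σ : Sentence) → Σ₁ σ → Sentence
bracket σ h = ∃' (toFormula (Φ ∧F flatSentence h) (λ _ → var zero))

axiomSize : ∀ {ψ} → R₀ ψ → ℕ
axiomSize (R₀+ m n) = m N.+ n
axiomSize (R₀× m n) = (m N.+ n) N.+ m N.* n
axiomSize (R₀≠ m n _) = m N.+ n
axiomSize (R₀≤ n) = n
axiomSize (R₀≼ m n _) = n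

R₀-axiom-from-facts : ∀ {T m} {Γ : List (Formula m)} {ψ} (r : R₀ ψ) → NumeralFacts T Γ (axiomSize r) → T ⨾ Γ ⊢ closedF ψ
R₀-axiom-from-facts (R₀+ m n) F = cast (sym (cong₂ _≐_ (cong₂ _⊕_ (renT-num _ m) (renT-num _ n)) (renT-num _ (m N.+ n)))) (num+ F m n NP.≤-refl)
R₀-axiom-from-facts (R₀× m n) F = cast (sym (cong₂ _≐_ (cong₂ _⊗_ (renT-num _ m) (renT-num _ n)) (renT-num _ (m N.* n))))
  (num* F m n (NP.m+n≤o⇒m≤o m (NP.m+n≤o⇒m≤o (m N.+ n) F')) (NP.m+n≤o⇒n≤o m (NP.m+n≤o⇒m≤o (m N.+ n) F')) (NP.m+n≤o⇒n≤o (m N.+ n) F'))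
  where F' = NP.≤-refl {(m N.+ n) N.+ m N.* n}
R₀-axiom-from-facts (R₀≠ m n ne) F = cast (sym (cong₂ (λ u v → ¬' (u ≐ v)) (renT-num _ m) (renT-num _ n)))
  (num≢ F m n (NP.m+n≤o⇒m≤o m NP.≤-refl) (NP.m+n≤o⇒n≤o m NP.≤-refl) ne)
R₀-axiom-from-facts (R₀≤ n) F = cast (sym (renF-R₀≤-axiom _ n)) (num-R₀≤ F n NP.≤-refl)
R₀-axiom-from-facts (R₀≼ m n p) F = cast (sym (cong₂ _≼_ (renT-num _ m) (renT-num _ n))) (num≤ F m n p NP.≤-refl)

LawsBelow-extend : ∀ {T X m} {Γ : List (Formula m)} {B k} → LawsBelow T X Γ B k → T ⨾ Γ ⊢ num (suc k) ≼ B → LawsBelow T X Γ B (suc k)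
LawsBelow-extend {T} {Γ = Γ} {B} {k} L p = record { lawsHold = lawsHold L ; numeralsBelow = h }
  where
    h : ∀ a → a N.≤ suc k → T ⨾ Γ ⊢ num a ≼ B
    h a q with NP.m≤n⇒m<n∨m≡n q
    ... | inj₁ r = numeralsBelow L a (NP.≤-pred r)
    ... | inj₂ refl = p

-- The climb from 0 up to s along law-suc-or-top.
module BoundCases {T : Theory} {X : Flat 1} (α : Sentence) (s : ℕ)
  (atNumeral : ∀ {m} {Γ : List (Formula m)} {B} j → LawsBelow T X Γ B j → T ⨾ Γ ⊢ B ≐ num j → T ⨾ Γ ⊢ closedF α)
  (aboveAll : ∀ {m} {Γ : List (Formula m)} {B} → LawsBelow T X Γ B s → T ⨾ Γ ⊢ closedF α) where

  climb : ∀ d k → k N.+ d ≡ s → ∀ {m} {Γ : List (Formula m)} {B} → LawsBelow T X Γ B k → T ⨾ Γ ⊢ closedF α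
  climb zero k e L = aboveAll (subst (LawsBelow T X _ _) (trans (sym (NP.+-identityʳ k)) e) L)
  climb (suc d) k e {m} {Γ} {B} L =
    ∨E (Laws.suc-or-top L k NP.≤-refl)
       (atNumeral k (LawsBelow-weaken there L) (≐sym (hyp (here refl))))
       (∃E (hyp (here refl))
         (cast (sym (renF-closedF suc α))
           (climb d (suc k) (trans (sym (NP.+-suc k d)) e)
             (LawsBelow-extend (LawsBelow-rename suc (λ x → there (∈-map⁺ wkF (there x))) L)
               (≼-substˡ (cast (cong (var zero ≐_) (cong `S (wkT-num k))) (∧E₂ (hyp (here refl)))) (∧E₁ (hyp (here refl))))))))

  bound-cases : ∀ {m} {Γ : List (Formula m)} {B} → T ⨾ Γ ⊢ toFormula (Φ ∧F X) (λ _ → B) → T ⨾ Γ ⊢ closedF α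
  bound-cases {m} {Γ} {B} D =
    ∃E (∧E₁ (∧E₁ D))
      (cast (sym (renF-closedF suc α))
        (climb s 0 refl (record
          { lawsHold = cast (toFormula-rename (Φ ∧F X) suc (λ _ → B)) (⊢-rename suc (λ x → there (∈-map⁺ wkF x)) D)
          ; numeralsBelow = λ { zero z≤n → ≼-substˡ (∧E₂ (hyp (here refl))) (∧E₁ (hyp (here refl))) } })))

bracket-proves : (σ : Sentence) (h : Σ₁ σ) → ⟨ bracket σ h ⟩ ⊢ σ
bracket-proves σ h = ∃E (cast (closedF-id (bracket σ h)) (ax refl))
  (cast (trans (subF-cong (λ ()) σ) (subF-var suc σ)) (flatΣ-derive h fromFin0 zero (λ _ → var zero) (∧E₂ (hyp (here refl)))))

R₀-proves-bracket : (σ : Sentence) (h : Σ₁ σ) → ℕ⊨ σ → R₀ ⊢ bracket σ h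
R₀-proves-bracket σ h x with flatΣ-complete h (λ ()) x
... | N , G with decideFlat (Φ ∧F flatSentence h) (λ _ → N) (λ _ → NP.≤-refl) (R₀-numeralFacts {Γ = []} N)
...   | inj₁ (_ , d) = ∃I (num N) (cast (sym (toFormula-subst (Φ ∧F flatSentence h) (single (num N)) (λ _ → var zero))) d)
...   | inj₂ (ns , _) = ⊥-elim (ns (Φ-valid (λ _ → N) , G fromFin0 zero (λ _ → N) (λ ()) NP.≤-refl))

bracket-proves-R₀ : (σ : Sentence) (h : Σ₁ σ) → ℕ⊨ (¬' σ) → ⟨ bracket σ h ⟩ ⊢all R₀
bracket-proves-R₀ σ h nσ ψ r = ∃E (cast (closedF-id (bracket σ h)) (ax refl))
  (cast (renF-cong (λ ()) ψ) (BoundCases.bound-cases ψ (axiomSize r) atNumeral (λ L → R₀-axiom-from-facts r (laws⇒numeralFacts L)) (hyp (here refl))))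
  where
    atNumeral : ∀ {m} {Γ : List (Formula m)} {B} j → LawsBelow ⟨ bracket σ h ⟩ (flatSentence h) Γ B j → ⟨ bracket σ h ⟩ ⨾ Γ ⊢ B ≐ num j → ⟨ bracket σ h ⟩ ⨾ Γ ⊢ closedF ψ
    atNumeral {B = B} j L eq with decideFlat (flatSentence h) (λ _ → j) (λ _ → NP.≤-refl) (laws⇒numeralFacts L)
    ... | inj₁ (sat , _) = ⊥-elim (nσ (Sat-cong (λ ()) σ (flatΣ-sound h fromFin0 zero (λ _ → j) sat)))
    ... | inj₂ (_ , ref) = ⊢-explode (⇒E ref
           (≐-rewrite (toFormula (flatSentence h) (λ _ → var zero)) eq (toFormula-subst (flatSentence h) (single B) (λ _ → var zero)) (toFormula-subst (flatSentence h) (single (num j)) (λ _ → var zero))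
               (∧E₂ (lawsHold L))))

theorem2p9 : Σ ((σ : Sentence) → Σ₁ σ → Sentence) (λ box →
               (σ : Sentence) (h : Σ₁ σ) →
                 (⟨ box σ h ⟩ ⊢ σ)
                 × (ℕ⊨ σ → R₀ ⊢ box σ h)
                 × (ℕ⊨ (¬' σ) → ⟨ box σ h ⟩ ⊢all R₀))
theorem2p9 = bracket , λ σ h → bracket-proves σ h , R₀-proves-bracket σ h , bracket-proves-R₀ σ h
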